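{- Let $M=(E,\mathcal{B})$ be any matroid of rank $r$ with ground set $E$ and set of bases $\mathcal{B}$, and let $0\le m\le r$. Let $\mathcal{T}=(T_1,\dots,T_{r-m})$ be a sequence of subsets of $E$ and let $Q,R\subseteq E$ be subsets. For $0\le k\le m$ define $$B_k(\mathcal{T},Q,R):=B(T_1,\dots,T_{r-m},\underbrace{Q,\dots,Q}_{k\text{ times}},\underbrace{R,\dots,R}_{m-k\text{ times}}).$$ Then the sequence $B_0(\mathcal{T},Q,R),\dots,B_m(\mathcal{T},Q,R)$ is log-concave.
   Context: For subsets $S_1,\dots,S_r\subseteq E$ of the ground set of a matroid of rank $r$, $B(S_1,\dots,S_r)$ is the number of sequences $(y_1,\dots,y_r)\in S_1\times\cdots\times S_r$ such that $\{y_1,\dots,y_r\}\in\mathcal{B}$. A sequence $a_0,\dots,a_m$ of non-negative reals is log-concave if $a_k^2\ge a_{k-1}a_{k+1}$ for all $1\le k\le m-1$. -}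

module Defs where

open import Data.Fin using (Fin)
open import Data.Fin.Subset using (Subset; _∈_; _∉_; _∪_; _-_; ⁅_⁆; ⋃; ∣_∣)
open import Data.Fin.Subset.Properties using (_∈?_)
open import Data.List using (List; []; _∷_; allFin; cartesianProductWith; filter; length)
open import Data.Nat using (ℕ; suc; pred; _*_; _∸_; _^_; _≤_; _<_)
open import Data.Product using (∃; _×_; proj₁)
open import Data.Vec using (Vec; []; _∷_; _++_; map; replicate; toList)
open import Relation.Unary using (Decidable)

-- A matroid on the ground set Fin n, presented by its bases.  Decidability of
-- IsBasis is automatic classically; here it is what allows bases to be counted.
record Matroid (n : ℕ) : Set₁ where
  field
    IsBasis  : Subset n → Set
    isBasis? : Decidable IsBasis
    nonempty : ∃ IsBasis
    exchange : ∀ {B₁ B₂} → IsBasis B₁ → IsBasis B₂ →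
               ∀ {x} → x ∈ B₁ → x ∉ B₂ →
               ∃ λ y → y ∈ B₂ × y ∉ B₁ × IsBasis ((B₁ - x) ∪ ⁅ y ⁆)

open Matroid

-- By the exchange axiom all bases have the same size, so the choice of basis
-- is immaterial.
rank : ∀ {n} → Matroid n → ℕ
rank M = ∣ proj₁ (nonempty M) ∣

elements : ∀ {n} → Subset n → List (Fin n)
elements S = filter (_∈? S) (allFin _)

-- All of S₁ × ⋯ × Sₛ, each sequence listed exactly once.
choices : ∀ {n s} → Vec (Subset n) s → List (Vec (Fin n) s)
choices []       = [] ∷ []
choices (S ∷ Ss) = cartesianProductWith _∷_ (elements S) (choices Ss)

-- The set {y₁,…,yₛ}; repeated entries collapse.
underlyingSet : ∀ {n s} → Vec (Fin n) s → Subset n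
underlyingSet y = ⋃ (toList (map ⁅_⁆ y))

-- B(S₁,…,Sₛ).  The length s is left free so that no casts are needed; the
-- intended case is s = rank M, where a counted sequence has distinct entries.
basisCount : ∀ {n s} → Matroid n → Vec (Subset n) s → ℕ
basisCount M S = length (filter (λ y → isBasis? M (underlyingSet y)) (choices S))

-- B_k(𝒯,Q,R), meaningful for k ≤ m.
mixedBasisCount : ∀ {n t} → Matroid n → (m : ℕ) →
                  Vec (Subset n) t → (Q R : Subset n) → ℕ → ℕ
mixedBasisCount M m T Q R k =
  basisCount M (T ++ (replicate k Q ++ replicate (m ∸ k) R))

-- Log-concavity of the finite sequence a₀,…,aₘ; only these terms are used.
LogConcave : ℕ → (ℕ → ℕ) → Set
LogConcave m a = ∀ k → 1 ≤ k → k < m → a (pred k) * a (suc k) ≤ a k ^ 2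

{-# OPTIONS --safe #-}
module Submission where

open import Defs
open import Data.Fin using (Fin; zero; suc)
open import Data.Fin.Properties using (any?)
import Data.Fin.Properties as Fin
open import Data.Fin.Subset
  using (Subset; inside; outside; _∪_; ⁅_⁆; ⋃; _─_)
  renaming (_∈_ to _∈ˢ_; _∉_ to _∉ˢ_; _⊆_ to _⊆ˢ_; _-_ to _-ˢ_; ∣_∣ to ∣_∣ˢ)
open import Data.Fin.Subset.Properties
open import Data.Integer
  using (ℤ; +_; -[1+_]; _+_; _*_; _-_; -_; _^_; _≤_; _<_; 0ℤ; 1ℤ; +≤+; +<+; -≤+; -<+; ∣_∣; nonNegative; positive)
open import Data.Integer.Properties
open import Data.Integer.Tactic.RingSolver using (solve-∀)
open import Data.List as List
  using (List; []; _∷_; foldr; _++_; length; filter; tabulate; cartesianProductWith)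
import Data.List.Properties as List
open import Data.List.Membership.Propositional using (_∈_)
open import Data.List.Relation.Unary.All using (All; []; _∷_)
open import Data.List.Relation.Unary.Any using (here; there)
open import Data.List.Relation.Binary.Permutation.Propositional
  using (_↭_; refl; prep; swap; ↭-sym)
  renaming (trans to ↭-trans)
open import Data.List.Relation.Binary.Permutation.Propositional.Properties
  using (shift; ↭-length; ++⁺ˡ; All-resp-↭)
open import Data.Nat as ℕ using (ℕ; zero; suc; z≤n; s≤s)
import Data.Nat.Properties as ℕ
open import Data.Product using (∃; Σ-syntax; _×_; _,_; proj₁; proj₂)
open import Data.Sum using (_⊎_; inj₁; inj₂)
open import Data.Vec as Vec using (Vec; []; _∷_; toList; here; there)
import Data.Vec.Properties as Vec
open import Function using (_∘_; id)
open import Relation.Nullary using (¬_; Dec; yes; no; contradiction; ¬?)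
open import Relation.Nullary.Decidable using (_×-dec_; map′)
open import Relation.Unary using (Decidable)
open import Relation.Binary.PropositionalEquality
import Algebra.Properties.Semiring.Sum +-*-semiring as Sum

-- The counts are Σ φ(y₁,…,y_r) Π Sᵢ(yᵢ) with φ the indicator of ordered bases.  More
-- generally, contract all but two slots of φ with non-negative weight vectors: the
-- resulting symmetric matrix has at most one positive eigenvalue, and log-concavity is
-- the reverse Cauchy–Schwarz inequality for Q and R.  Induct on the number of
-- contractions.  With none left, the matrix is the adjacency matrix of a complete
-- multipartite graph.  Otherwise it is M = Σᵢ wᵢ τᵢ with τᵢ coming from the contraction
-- of the matroid by i, and one may assume w > 0 (replace w by k w + 1 and let k → ∞)
-- and then w = 1 (rescale).  With d the row sums of M, 1 τᵢ 1 = dᵢ and x τᵢ 1 = (Mx)ᵢ,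
-- so the induction hypothesis gives x M x ≤ Σ (Mx)ᵢ² / dᵢ; that is, A = D⁻¹M satisfies
-- A ≤ A² and has no eigenvalue strictly between 0 and 1.  The top eigenvalue 1 is simple
-- since the support of M is again matroidal, hence connected.  Over ℤ, denominators are
-- cleared by a common multiple L, and eigenvalues are replaced by the growth of the
-- powers of L + A.

-- Order on ℤ and finite sums

0≤pos : ∀ n → 0ℤ ≤ + n
0≤pos n = +≤+ z≤n

0<1 : 0ℤ < 1ℤ
0<1 = +<+ (s≤s z≤n)

0≤+ : ∀ {a b} → 0ℤ ≤ a → 0ℤ ≤ b → 0ℤ ≤ a + b
0≤+ p q = +-mono-≤ p q

0≤* : ∀ {a b} → 0ℤ ≤ a → 0ℤ ≤ b → 0ℤ ≤ a * b
0≤* {a} {b} p q = subst (_≤ a * b) (*-zeroʳ a) (*-monoˡ-≤-nonNeg a {{nonNegative p}} q)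

0<* : ∀ {a b} → 0ℤ < a → 0ℤ < b → 0ℤ < a * b
0<* {a} {b} p q = subst (_< a * b) (*-zeroʳ a) (*-monoˡ-<-pos a {{positive p}} q)

0≤sq : ∀ a → 0ℤ ≤ a * a
0≤sq (+ n) = 0≤* {+ n} {+ n} (+≤+ z≤n) (+≤+ z≤n)
0≤sq -[1+ n ] = +≤+ z≤n

*-monoˡ-≤ : ∀ {a b c} → 0ℤ ≤ c → a ≤ b → c * a ≤ c * b
*-monoˡ-≤ {c = c} p = *-monoˡ-≤-nonNeg c {{nonNegative p}}

*-cancelˡ-≤ : ∀ {a b c} → 0ℤ < c → c * a ≤ c * b → a ≤ b
*-cancelˡ-≤ {a} {b} {c} p = *-cancelˡ-≤-pos a b c {{positive p}}

≤-from : ∀ {a b c} → 0ℤ ≤ c → c ≡ b - a → a ≤ b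
≤-from p refl = 0≤i-j⇒j≤i p

0≤⇒0⊎0< : ∀ {a} → 0ℤ ≤ a → a ≡ 0ℤ ⊎ 0ℤ < a
0≤⇒0⊎0< {+ zero} _ = inj₁ refl
0≤⇒0⊎0< {+ suc n} _ = inj₂ (+<+ (s≤s z≤n))

0<⇒1≤ : ∀ {a} → 0ℤ < a → 1ℤ ≤ a
0<⇒1≤ = i<j⇒suc[i]≤j

-- Opaque, so that two sums are unified by comparing their summands.
opaque
  sum : ∀ {n} → (Fin n → ℤ) → ℤ
  sum = Sum.sum

  sum-suc : ∀ {n} (f : Fin (suc n) → ℤ) → sum f ≡ f zero + sum (λ i → f (suc i))
  sum-suc f = refl

  ∑-cong : ∀ {n} {f g : Fin n → ℤ} → (∀ i → f i ≡ g i) → sum f ≡ sum g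
  ∑-cong = Sum.sum-cong-≗

  ∑-comm : ∀ {m n} (f : Fin m → Fin n → ℤ) → sum (λ i → sum (f i)) ≡ sum (λ j → sum (λ i → f i j))
  ∑-comm = Sum.∑-comm

  ∑-distrib-+ : ∀ {n} (f g : Fin n → ℤ) → sum (λ i → f i + g i) ≡ sum f + sum g
  ∑-distrib-+ = Sum.∑-distrib-+

  *-distribˡ-sum : ∀ {n} a (f : Fin n → ℤ) → a * sum f ≡ sum (λ i → a * f i)
  *-distribˡ-sum = Sum.*-distribˡ-sum

  *-distribʳ-sum : ∀ {n} a (f : Fin n → ℤ) → sum f * a ≡ sum (λ i → f i * a)
  *-distribʳ-sum = Sum.*-distribʳ-sum

  ∑-0≤ : ∀ {n} {f : Fin n → ℤ} → (∀ i → 0ℤ ≤ f i) → 0ℤ ≤ sum f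
  ∑-0≤ {zero} h = ≤-refl
  ∑-0≤ {suc n} h = 0≤+ (h zero) (∑-0≤ (h ∘ suc))

  ∑-mono : ∀ {n} {f g : Fin n → ℤ} → (∀ i → f i ≤ g i) → sum f ≤ sum g
  ∑-mono {zero} h = ≤-refl
  ∑-mono {suc n} h = +-mono-≤ (h zero) (∑-mono (h ∘ suc))

  ∑-≥-term : ∀ {n} {f : Fin n → ℤ} → (∀ i → 0ℤ ≤ f i) → ∀ i → f i ≤ sum f
  ∑-≥-term {f = f} h zero = subst (_≤ sum f) (+-identityʳ _) (+-monoʳ-≤ (f zero) (∑-0≤ (h ∘ suc)))
  ∑-≥-term {f = f} h (suc i) = subst (_≤ sum f) (+-identityˡ _) (+-mono-≤ (h zero) (∑-≥-term (h ∘ suc) i))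

  ∑-≢0 : ∀ {n} {f : Fin n → ℤ} → sum f ≢ 0ℤ → ∃ λ i → f i ≢ 0ℤ
  ∑-≢0 {zero} h = contradiction refl h
  ∑-≢0 {suc n} {f} h with f zero ≟ 0ℤ
  ... | no q = zero , q
  ... | yes q with ∑-≢0 {f = f ∘ suc} (λ e → h (cong₂ _+_ q e))
  ...   | i , r = suc i , r

  ∑-zero : ∀ {n} {f : Fin n → ℤ} → (∀ i → f i ≡ 0ℤ) → sum f ≡ 0ℤ
  ∑-zero {zero} h = refl
  ∑-zero {suc n} h = cong₂ _+_ (h zero) (∑-zero (h ∘ suc))

∑-prod : ∀ {m n} (f : Fin m → ℤ) (g : Fin n → ℤ) → sum (λ i → sum (λ j → f i * g j)) ≡ sum f * sum g
∑-prod f g = trans (∑-cong (λ i → sym (*-distribˡ-sum (f i) g))) (sym (*-distribʳ-sum (sum g) f))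

∑-lin : ∀ {n} (a b : ℤ) (f g : Fin n → ℤ) → sum (λ i → a * f i + b * g i) ≡ a * sum f + b * sum g
∑-lin a b f g = trans (∑-distrib-+ (λ i → a * f i) (λ i → b * g i))
    (sym (cong₂ _+_ (*-distribˡ-sum a f) (*-distribˡ-sum b g)))

-- Vectors, matrices and bilinear forms

Vect : ℕ → Set
Vect n = Fin n → ℤ

Mat : ℕ → Set
Mat n = Fin n → Fin n → ℤ

infix 8 _∙_
_∙_ : ∀ {n} → Vect n → Vect n → ℤ
x ∙ y = sum (λ i → x i * y i)

app : ∀ {n} → Mat n → Vect n → Vect n
app M x i = M i ∙ x

bil : ∀ {n} → Mat n → Vect n → Vect n → ℤ
bil M x y = x ∙ app M y

lin : ∀ {n} → ℤ → Vect n → ℤ → Vect n → Vect n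
lin a x b y i = a * x i + b * y i

∙-comm : ∀ {n} (x y : Vect n) → x ∙ y ≡ y ∙ x
∙-comm x y = ∑-cong (λ i → *-comm (x i) (y i))

∙-linʳ : ∀ {n} z a (x : Vect n) b y → z ∙ lin a x b y ≡ a * (z ∙ x) + b * (z ∙ y)
∙-linʳ z a x b y = trans (∑-cong (λ i → eq (z i) a (x i) b (y i))) (∑-lin a b (λ i → z i * x i)
    (λ i → z i * y i))
  where
  eq : ∀ z a x b y → z * (a * x + b * y) ≡ a * (z * x) + b * (z * y)
  eq = solve-∀

∙-linˡ : ∀ {n} z a (x : Vect n) b y → lin a x b y ∙ z ≡ a * (x ∙ z) + b * (y ∙ z)
∙-linˡ z a x b y = trans (∙-comm (lin a x b y) z) (trans (∙-linʳ z a x b y)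
  (cong₂ (λ u v → a * u + b * v) (∙-comm z x) (∙-comm z y)))

Symmetric : ∀ {n} → Mat n → Set
Symmetric M = ∀ i j → M i j ≡ M j i

bil-double : ∀ {n} (M : Mat n) x y → bil M x y ≡ sum (λ i → sum (λ j → x i * (M i j * y j)))
bil-double M x y = ∑-cong (λ i → *-distribˡ-sum (x i) (λ j → M i j * y j))

bil-sym : ∀ {n} {M : Mat n} → Symmetric M → ∀ x y → bil M x y ≡ bil M y x
bil-sym {M = M} s x y = trans (bil-double M x y) (trans (∑-comm (λ i j → x i * (M i j * y j)))
  (trans (∑-cong (λ j → ∑-cong (λ i → trans (eq (x i) (M i j) (y j)) (cong (λ m → y j * (m * x i))
      (s i j))))) (sym (bil-double M y x))))
  where
  eq : ∀ x m y → x * (m * y) ≡ y * (m * x)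
  eq = solve-∀

bil-linˡ : ∀ {n} (M : Mat n) a x b y z → bil M (lin a x b y) z ≡ a * bil M x z + b * bil M y z
bil-linˡ M a x b y z = ∙-linˡ (app M z) a x b y

bil-linʳ : ∀ {n} (M : Mat n) a x b y z → bil M z (lin a x b y) ≡ a * bil M z x + b * bil M z y
bil-linʳ M a x b y z = trans (∑-cong (λ i → cong (z i *_) (∙-linʳ (M i) a x b y))) (∙-linʳ z a (app M x) b
    (app M y))

bil-quad : ∀ {n} {M : Mat n} → Symmetric M → ∀ a x b y →
  bil M (lin a x b y) (lin a x b y) ≡ a * a * bil M x x + (+ 2) * (a * b * bil M x y) + b * b * bil M y y
bil-quad {M = M} s a x b y =
  trans (bil-linˡ M a x b y _)
  (trans (cong₂ (λ u v → a * u + b * v) (bil-linʳ M a x b y x) (bil-linʳ M a x b y y))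
  (trans (cong (λ t → a * (a * bil M x x + b * bil M x y) + b * (a * t + b * bil M y y)) (bil-sym s y x))
  (eq a b (bil M x x) (bil M x y) (bil M y y))))
  where
  eq : ∀ a b p q r → a * (a * p + b * q) + b * (a * q + b * r) ≡ a * a * p + (+ 2) * (a * b * q) + b * b * r
  eq = solve-∀

-- For symmetric M: at most one positive eigenvalue.
Hyper : ∀ {n} → Mat n → Set
Hyper M = ∀ x y → 0ℤ ≤ bil M y y → bil M x x * bil M y y ≤ bil M x y * bil M x y

sq-pos : ∀ {a} → a ≢ 0ℤ → 0ℤ < a * a
sq-pos {a} h with 0≤⇒0⊎0< (0≤sq a)
... | inj₂ p = p
... | inj₁ p with i*j≡0⇒i≡0∨j≡0 a p
...   | inj₁ q = contradiction q h
...   | inj₂ q = contradiction q h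

-- Only the case `0ℤ < bil M x x` has content, and there `ℓ ∙ x` is non-zero. The combination `z` of
-- `x` and `y` is killed by `ℓ`, so its form is at most zero; multiplied by `bil M x x` and
-- completed to a square, this is the claim times the square of `ℓ ∙ x`.
hyper-from-functional : ∀ {n} {M : Mat n} → Symmetric M → (ℓ : Vect n) →
  (∀ x → ℓ ∙ x ≡ 0ℤ → bil M x x ≤ 0ℤ) → Hyper M
hyper-from-functional {M = M} s ℓ h x y 0≤yy with 0ℤ <? bil M x x
... | no ¬p = ≤-trans (subst (bil M x x * bil M y y ≤_) (*-zeroˡ (bil M y y))
    (*-monoʳ-≤-nonNeg (bil M y y) {{nonNegative 0≤yy}} (≮⇒≥ ¬p))) (0≤sq (bil M x y))
... | yes p with ℓ ∙ x ≟ 0ℤ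
...   | yes q = contradiction (<-≤-trans p (h x q)) (<-irrefl refl)
...   | no q = *-cancelˡ-≤ (sq-pos q) (≤-from (0≤+ (0≤sq (α * bil M x x - β * bil M x y))
    (0≤* (<⇒≤ p) (i≤j⇒0≤j-i zMz≤0))) (eq α β (bil M x x) (bil M x y) (bil M y y)))
  where
  α = ℓ ∙ y
  β = ℓ ∙ x
  z = lin α x (- β) y
  cancel : ∀ a b → a * b + - b * a ≡ 0ℤ
  cancel = solve-∀
  zMz≤0 : α * α * bil M x x + (+ 2) * (α * - β * bil M x y) + - β * - β * bil M y y ≤ 0ℤ
  zMz≤0 = subst (_≤ 0ℤ) (bil-quad s α x (- β) y) (h z (trans (∙-linʳ ℓ α x (- β) y) (cancel α β)))
  eq : ∀ a b p q r → (a * p - b * q) * (a * p - b * q) + p *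
      (0ℤ - (a * a * p + (+ 2) * (a * - b * q) + - b * - b * r)) ≡ b * b * (q * q) - b * b * (p * r)
  eq = solve-∀

-- Lagrange's identity.
cauchy-schwarz : ∀ {n} {d : Vect n} → (∀ i → 0ℤ ≤ d i) → ∀ (x y : Vect n) →
  sum (λ i → d i * (x i * y i)) * sum (λ i → d i * (x i * y i)) ≤
  sum (λ i → d i * (x i * x i)) * sum (λ i → d i * (y i * y i))
cauchy-schwarz {n} {d} h x y = *-cancelˡ-≤ {Z * Z} {X * Y} {+ 2} (+<+ (s≤s z≤n))
    (≤-from nonneg (trans expand (eq₂ X Y Z)))
  where
  f g k : Vect n
  f i = d i * (x i * x i)
  g i = d i * (y i * y i)
  k i = d i * (x i * y i)
  X = sum f
  Y = sum g
  Z = sum k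
  t : Mat n
  t i j = d i * d j * ((x i * y j - x j * y i) * (x i * y j - x j * y i))
  nonneg : 0ℤ ≤ sum (λ i → sum (t i))
  nonneg = ∑-0≤ (λ i → ∑-0≤ (λ j → 0≤* (0≤* (h i) (h j)) (0≤sq (x i * y j - x j * y i))))
  eq₁ : ∀ a b p q r s → a * b * ((p * s - r * q) * (p * s - r * q))
      ≡ 1ℤ * (1ℤ * (a * (p * p) * (b * (s * s))) + 1ℤ * (a * (q * q) * (b * (r * r)))) + (- (+ 2)) *
      (a * (p * q) * (b * (r * s)))
  eq₁ = solve-∀
  eq₂ : ∀ a b c → 1ℤ * (1ℤ * (a * b) + 1ℤ * (b * a)) + (- (+ 2)) * (c * c) ≡ + 2 * (a * b) - + 2 * (c * c)
  eq₂ = solve-∀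
  ∑₂-lin : ∀ a b (u v : Mat n) → sum (λ i → sum (λ j → a * u i j + b * v i j)) ≡ a * sum (λ i → sum (u i))
      + b * sum (λ i → sum (v i))
  ∑₂-lin a b u v = trans (∑-cong (λ i → ∑-lin a b (u i) (v i))) (∑-lin a b (λ i → sum (u i))
      (λ i → sum (v i)))
  expand : sum (λ i → sum (t i)) ≡ 1ℤ * (1ℤ * (X * Y) + 1ℤ * (Y * X)) + (- (+ 2)) * (Z * Z)
  expand = trans (∑-cong (λ i → ∑-cong (λ j → eq₁ (d i) (d j) (x i) (y i) (x j) (y j))))
    (trans (∑₂-lin 1ℤ (- (+ 2)) (λ i j → 1ℤ * (f i * g j) + 1ℤ * (g i * f j)) (λ i j → k i * k j))
    (cong₂ (λ u v → 1ℤ * u + (- (+ 2)) * v)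
      (trans (∑₂-lin 1ℤ 1ℤ (λ i j → f i * g j) (λ i j → g i * f j)) (cong₂ (λ u v → 1ℤ * u + 1ℤ * v)
          (∑-prod f g) (∑-prod g f)))
      (∑-prod k k)))

-- Dirichlet forms and cleared denominators

rowSum : ∀ {n} → Mat n → Vect n
rowSum M i = sum (M i)

-- Twice the quadratic form of the Laplacian of the graph with edge weights `M`. It serves for the
-- energy of a matrix and, with `M` the rank one matrix `d i * d j`, for a variance.
dirichlet : ∀ {n} {M : Mat n} → Symmetric M → ∀ (x : Vect n) →
  sum (λ i → sum (λ j → M i j * ((x i - x j) * (x i - x j)))) ≡
  + 2 * (sum (λ i → rowSum M i * (x i * x i)) - bil M x x)
dirichlet {M = M} s x = trans (∑-cong λ i → trans (∑-cong λ j → eq₁ (M i j) (x i) (x j)) (∑-lin 1ℤ 1ℤ _ _))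
  (trans (∑-lin 1ℤ 1ℤ _ _) (trans (cong₂ (λ u v → 1ℤ * u + 1ℤ * v) half₁ half₂) (eq₂ P (bil M x x))))
  where
  P = sum (λ i → rowSum M i * (x i * x i))
  eq₁ : ∀ m a b → m * ((a - b) * (a - b)) ≡ 1ℤ * (1ℤ * (m * (a * a)) + - 1ℤ * (a * (m * b))) + 1ℤ *
      (1ℤ * (m * (b * b)) + - 1ℤ * (a * (m * b)))
  eq₁ = solve-∀
  eq₂ : ∀ p q → 1ℤ * (1ℤ * p + - 1ℤ * q) + 1ℤ * (1ℤ * p + - 1ℤ * q) ≡ + 2 * (p - q)
  eq₂ = solve-∀
  diag : sum (λ i → sum (λ j → M i j * (x i * x i))) ≡ P
  diag = ∑-cong λ i → sym (*-distribʳ-sum (x i * x i) (M i))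
  half : ∀ (u : Mat _) → sum (λ i → sum (u i)) ≡ P → sum
      (λ i → sum (λ j → 1ℤ * u i j + - 1ℤ * (x i * (M i j * x j)))) ≡ 1ℤ * P + - 1ℤ * bil M x x
  half u e = trans (∑-cong λ i → ∑-lin 1ℤ (- 1ℤ) (u i) _) (trans (∑-lin 1ℤ (- 1ℤ) _ _)
    (cong₂ (λ a b → 1ℤ * a + - 1ℤ * b) e (sym (bil-double M x x))))
  half₁ = half (λ i j → M i j * (x i * x i)) diag
  half₂ = half (λ i j → M i j * (x j * x j)) (trans (∑-comm (λ i j → M i j * (x j * x j)))
    (trans (∑-cong λ j → ∑-cong λ i → cong (_* (x j * x j)) (s i j)) diag))

-- Here `e` stands for `L / d`, so that division by weights or row sums stays inside ℤ. Where `d`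
-- vanishes only the sign of `e` is promised.
common-multiple : ∀ {n} (d : Vect n) → (∀ i → 0ℤ ≤ d i) →
  ∃ λ L → 0ℤ < L × ∃ λ (e : Vect n) → ∀ i → 0ℤ ≤ e i × (0ℤ < d i → e i * d i ≡ L)
common-multiple {zero} d h = 1ℤ , +<+ (s≤s z≤n) , (λ ()) , λ ()
common-multiple {suc n} d h with common-multiple (d ∘ suc) (h ∘ suc) | 0≤⇒0⊎0< (h zero)
... | L , L>0 , e , p | inj₁ z = L , L>0 , (λ { zero → 0ℤ ; (suc i) → e i }) ,
  λ { zero → ≤-refl , (λ q → contradiction q (<-irrefl (sym z))) ; (suc i) → p i }
... | L , L>0 , e , p | inj₂ d>0 = L * d zero , 0<* L>0 d>0 , (λ { zero → L ; (suc i) → e i * d zero }) ,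
  λ { zero → <⇒≤ L>0 , (λ _ → refl) ; (suc i) → 0≤* (proj₁ (p i)) (h zero) , λ q
      → trans (eq (e i) (d zero) (d (suc i))) (cong (_* d zero) (proj₂ (p i) q)) }
  where
  eq : ∀ e d c → e * d * c ≡ e * c * d
  eq = solve-∀

-- Powers and their growth

0≤^ : ∀ {a} → 0ℤ ≤ a → ∀ n → 0ℤ ≤ a ^ n
0≤^ p zero = +≤+ z≤n
0≤^ p (suc n) = 0≤* p (0≤^ p n)

^-distribʳ-* : ∀ (a b : ℤ) n → (a * b) ^ n ≡ a ^ n * b ^ n
^-distribʳ-* a b zero = refl
^-distribʳ-* a b (suc n) = trans (cong (a * b *_) (^-distribʳ-* a b n)) (eq a b (a ^ n) (b ^ n))
  where
  eq : ∀ a b c d → a * b * (c * d) ≡ a * c * (b * d)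
  eq = solve-∀

^-double : ∀ (a : ℤ) n → a ^ (2 ℕ.^ suc n) ≡ a ^ (2 ℕ.^ n) * a ^ (2 ℕ.^ n)
^-double a n = trans (cong (λ m → a ^ (2 ℕ.^ n ℕ.+ m)) (ℕ.+-identityʳ (2 ℕ.^ n)))
    (^-distribˡ-+-* a (2 ℕ.^ n) (2 ℕ.^ n))

iterate : {V : Set} → (V → V) → ℕ → V → V
iterate f zero x = x
iterate f (suc k) x = f (iterate f k x)

-- Bernoulli's inequality for `(1 + q / p) ^ n`, multiplied through by `p ^ (n + 1)`.
bernoulli : ∀ {p q} → 0ℤ ≤ p → 1ℤ ≤ q → ∀ n → p ^ n * p + + n * (q * p ^ n) ≤ (p + q) ^ n * p
bernoulli {p} {q} h k zero = ≤-reflexive (eq p q)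
  where eq : ∀ p q → 1ℤ * p + 0ℤ * (q * 1ℤ) ≡ 1ℤ * p
        eq = solve-∀
bernoulli {p} {q} h k (suc n) = ≤-trans
  (≤-from (0≤* (+≤+ (z≤n {n})) (0≤* (0≤* (0≤q) (0≤q)) (0≤^ h n))) (eq p q (p ^ n) (+ n)))
  (≤-trans (*-monoˡ-≤ (0≤+ h 0≤q) (bernoulli h k n)) (≤-reflexive (eq' p q ((p + q) ^ n))))
  where
  0≤q : 0ℤ ≤ q
  0≤q = ≤-trans (+≤+ z≤n) k
  eq : ∀ p q r m → m * (q * q * r) ≡ (p + q) * (r * p + m * (q * r)) - (p * r * p + (1ℤ + m) * (q * (p * r)))
  eq = solve-∀
  eq' : ∀ p q r → (p + q) * (r * p) ≡ (p + q) * r * p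
  eq' = solve-∀

n<2^n : ∀ n → n ℕ.< 2 ℕ.^ n
n<2^n zero = s≤s z≤n
n<2^n (suc n) = ℕ.+-mono-≤ (ℕ.≤-trans (s≤s z≤n) (n<2^n n)) (ℕ.≤-trans (n<2^n n) (ℕ.m≤m+n _ _))

-- By `bernoulli` the ratio of the two powers is at least `1 + N * q / p`, which is unbounded in the
-- exponent `N`. The exponents are powers of two because the estimates to be refuted come from
-- repeated squaring.
exponential-dominates : ∀ {p q} → 0ℤ < p → 0ℤ < q → ∀ {c} → 0ℤ ≤ c → ¬ (∀ k → (p + q) ^ (2 ℕ.^ suc k)
    ≤ p ^ (2 ℕ.^ suc k) * c)
exponential-dominates {p} {q} p>0 q>0 {c} 0≤c h = <⇒≱ N>pc (*-cancelˡ-≤ {c = p ^ N} (0<^ N) bound)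
  where
  0<^ : ∀ n → 0ℤ < p ^ n
  0<^ zero = +<+ (s≤s z≤n)
  0<^ (suc n) = 0<* p>0 (0<^ n)
  -- Any exponent above `p * c` contradicts the bound, and `n < 2 ^ n` supplies one.
  k = ∣ p * c ∣
  N = 2 ℕ.^ suc k
  N>pc : p * c < + N
  N>pc = subst (_< + N) (0≤i⇒+∣i∣≡i (0≤* (<⇒≤ p>0) 0≤c)) (+<+ (ℕ.<-≤-trans (n<2^n k) (ℕ.m≤m+n _ _)))
  eq : ∀ P c p → P * c * p ≡ P * (p * c)
  eq = solve-∀
  eq₂ : ∀ P p N q → P * p + N * P * (q - 1ℤ) ≡ (P * p + N * (q * P)) - P * N
  eq₂ = solve-∀
  bound : p ^ N * + N ≤ p ^ N * (p * c)
  bound = ≤-trans (≤-from (0≤+ (0≤* (<⇒≤ (0<^ N)) (<⇒≤ p>0)) (0≤* (0≤* (+≤+ (z≤n {N})) (<⇒≤ (0<^ N)))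
      (i≤j⇒0≤j-i (0<⇒1≤ q>0)))) (eq₂ (p ^ N) p (+ N) q))
    (≤-trans (bernoulli (<⇒≤ p>0) (0<⇒1≤ q>0) N) (≤-trans (*-monoʳ-≤-nonNeg p {{nonNegative (<⇒≤ p>0)}}
        (h k)) (≤-reflexive (eq (p ^ N) c p))))

-- Symmetrizable operators

-- If A is self-adjoint for both ⟨_,_⟩ and K x y = L ⟨x,y⟩ - ⟨x,Ay⟩ and negative for
-- the latter (square-bound), then it is negative for the former: B = L + A does not
-- expand the K-norm beyond L, whereas ⟨x,Ax⟩ > 0 would force ⟨x,Bᵏx⟩ to outgrow Lᵏ.
module _ {V : Set} (⟨_,_⟩ : V → V → ℤ) (A B : V → V) (L C : ℤ)
  (L>0 : 0ℤ < L) (0≤C : 0ℤ ≤ C)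
  (symm : ∀ x y → ⟨ x , y ⟩ ≡ ⟨ y , x ⟩)
  (selfAdjoint : ∀ x y → ⟨ A x , y ⟩ ≡ ⟨ x , A y ⟩)
  (B-expand : ∀ x y → ⟨ B x , y ⟩ ≡ L * ⟨ x , y ⟩ + ⟨ A x , y ⟩)
  (psd : ∀ x → 0ℤ ≤ ⟨ x , x ⟩)
  (cs : ∀ x y → ⟨ x , y ⟩ * ⟨ x , y ⟩ ≤ ⟨ x , x ⟩ * ⟨ y , y ⟩)
  (square-bound : ∀ x → L * ⟨ x , A x ⟩ ≤ ⟨ A x , A x ⟩)
  (contraction : ∀ x → ⟨ A x , A x ⟩ ≤ L * L * ⟨ x , x ⟩)
  (poincaré : ∀ x → ⟨ x , x ⟩ ≤ C * (L * ⟨ x , x ⟩ - ⟨ x , A x ⟩))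
  where

  private
    B-expandʳ : ∀ x y → ⟨ x , B y ⟩ ≡ L * ⟨ x , y ⟩ + ⟨ x , A y ⟩
    B-expandʳ x y = trans (symm x (B y)) (trans (B-expand y x) (cong₂ (λ u v → L * u + v) (symm y x)
        (symm (A y) x)))

    B-selfAdjoint : ∀ x y → ⟨ B x , y ⟩ ≡ ⟨ x , B y ⟩
    B-selfAdjoint x y = trans (B-expand x y) (trans (cong (_+_ (L * ⟨ x , y ⟩)) (selfAdjoint x y))
        (sym (B-expandʳ x y)))

    AB : ∀ x y → ⟨ A (B x) , y ⟩ ≡ L * ⟨ A x , y ⟩ + ⟨ A (A x) , y ⟩
    AB x y = trans (selfAdjoint (B x) y) (trans (B-expand x (A y))
        (sym (cong₂ (λ u v → L * u + v) (selfAdjoint x y) (selfAdjoint (A x) y))))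

    ABʳ : ∀ x y → ⟨ y , A (B x) ⟩ ≡ L * ⟨ y , A x ⟩ + ⟨ y , A (A x) ⟩
    ABʳ x y = trans (symm y _) (trans (AB x y) (cong₂ (λ u v → L * u + v) (symm (A x) y) (symm (A (A x)) y)))

    K : V → ℤ
    K x = L * ⟨ x , x ⟩ - ⟨ x , A x ⟩

    -- By self-adjointness these are the moments ⟨x, Aᵏx⟩. Since `B` is `L + A`, those of `B x` are
    -- combinations of them.
    module Moments (x : V) where
      a₀ a₁ a₂ a₃ a₄ : ℤ
      a₀ = ⟨ x , x ⟩
      a₁ = ⟨ x , A x ⟩
      a₂ = ⟨ A x , A x ⟩
      a₃ = ⟨ A x , A (A x) ⟩
      a₄ = ⟨ A (A x) , A (A x) ⟩

      x,AAx : ⟨ x , A (A x) ⟩ ≡ a₂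
      x,AAx = sym (selfAdjoint x (A x))

      BB : ⟨ B x , B x ⟩ ≡ L * (L * a₀ + a₁) + (L * a₁ + a₂)
      BB = trans (B-expand x (B x)) (cong₂ (λ u v → L * u + v) (B-expandʳ x x)
        (trans (B-expandʳ (A x) x) (cong (λ u → L * u + a₂) (symm (A x) x))))

      BAB : ⟨ B x , A (B x) ⟩ ≡ L * (L * a₁ + a₂) + (L * a₂ + a₃)
      BAB = trans (B-expand x (A (B x))) (cong₂ (λ u v → L * u + v)
        (trans (ABʳ x x) (cong (_+_ (L * a₁)) x,AAx)) (ABʳ x (A x)))

      ABAB : ⟨ A (B x) , A (B x) ⟩ ≡ L * (L * a₂ + a₃) + (L * a₃ + a₄)
      ABAB = trans (AB x (A (B x))) (cong₂ (λ u v → L * u + v) (ABʳ x (A x))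
        (trans (ABʳ x (A (A x))) (cong (λ u → L * u + a₄) (symm (A (A x)) (A x)))))

    -- With c = - A, so that B = L - c, the bound follows from the identity
    -- L c (L - c) = (L - c) c (L - c) + c (L - c) c.
    K-B : ∀ x → K (B x) ≤ L * L * K x
    K-B x = *-cancelˡ-≤ L>0 (≤-from
      (0≤+ (0≤+ (0≤* (0≤* (<⇒≤ L>0) (<⇒≤ L>0)) (i≤j⇒0≤j-i (square-bound x))) (i≤j⇒0≤j-i sqB))
          (i≤j⇒0≤j-i (contraction (A x))))
      (trans (eq L a₀ a₁ a₂ a₃ a₄) (cong (λ u → L * (L * L * K x) - L * u)
          (sym (cong₂ (λ u v → L * u - v) BB BAB)))))
      where
      open Moments x
      sqB : L * (L * (L * a₁ + a₂) + (L * a₂ + a₃)) ≤ L * (L * a₂ + a₃) + (L * a₃ + a₄)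
      sqB = subst₂ _≤_ (cong (L *_) BAB) ABAB (square-bound (B x))
      eq : ∀ L a b c d e → L * L * (c - L * b) + (L * (L * c + d) + (L * d + e) - L *
          (L * (L * b + c) + (L * c + d))) + (L * L * c - e)
         ≡ L * (L * L * (L * a - b)) - L * (L * (L * (L * a + b) + (L * b + c)) -
             (L * (L * b + c) + (L * c + d)))
      eq = solve-∀

    K-iterate : ∀ x k → K (iterate B k x) ≤ L ^ k * L ^ k * K x
    K-iterate x zero = ≤-reflexive (eq (K x))
      where eq : ∀ a → a ≡ 1ℤ * 1ℤ * a
            eq = solve-∀
    K-iterate x (suc k) = ≤-trans (K-B (iterate B k x))
        (≤-trans (*-monoˡ-≤ (0≤* (<⇒≤ L>0) (<⇒≤ L>0)) (K-iterate x k)) (≤-reflexive (eq L (L ^ k) (K x))))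
      where eq : ∀ l p a → l * l * (p * p * a) ≡ l * p * (l * p) * a
            eq = solve-∀

    iterate-adjoint : ∀ k x y → ⟨ iterate B k x , y ⟩ ≡ ⟨ x , iterate B k y ⟩
    iterate-adjoint zero x y = refl
    iterate-adjoint (suc k) x y = trans (B-selfAdjoint (iterate B k x) y)
        (trans (iterate-adjoint k x (B y)) (cong ⟨ x ,_⟩ (comm k y)))
      where
      comm : ∀ k y → iterate B k (B y) ≡ B (iterate B k y)
      comm zero y = refl
      comm (suc k) y = cong B (comm k y)

    iterate-+ : ∀ j k (x : V) → iterate B j (iterate B k x) ≡ iterate B (j ℕ.+ k) x
    iterate-+ zero k x = refl
    iterate-+ (suc j) k x = cong B (iterate-+ j k x)

    module _ (x : V) where
      β : ℕ → ℤ
      β k = ⟨ x , iterate B k x ⟩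

      β-double : ∀ k → β (k ℕ.+ k) ≡ ⟨ iterate B k x , iterate B k x ⟩
      β-double k = trans (cong ⟨ x ,_⟩ (sym (iterate-+ k k x))) (sym (iterate-adjoint k x (iterate B k x)))

      -- Cauchy-Schwarz bounds the square of `β N` by `β 0 * β (2 N)`. Starting from `N = 1` and
      -- doubling, `β N / β 0` is at least `(β 1 / β 0) ^ N`; denominators are cleared.
      β-lower : 0ℤ < β 0 → 0ℤ ≤ β 1 → ∀ k → β 1 ^ (2 ℕ.^ k) * β 0 ≤ β 0 ^ (2 ℕ.^ k) * β (2 ℕ.^ k)
      β-lower p q zero = ≤-reflexive (eq (β 1) (β 0))
        where eq : ∀ a b → a * 1ℤ * b ≡ b * 1ℤ * a
              eq = solve-∀
      β-lower p q (suc k) = *-cancelˡ-≤ p (begin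
        b * (β 1 ^ (2 ℕ.^ suc k) * b)    ≡⟨ cong (λ t → b * (t * b)) (^-double (β 1) k) ⟩
        b * (s * s * b)                 ≡⟨ eq b s ⟩
        (s * b) * (s * b)               ≤⟨ sq-mono (0≤* (0≤^ q (2 ℕ.^ k)) (<⇒≤ p)) (β-lower p q k) ⟩
        (r * t) * (r * t)               ≡⟨ eq₂ r t ⟩
        r * r * (t * t)                 ≤⟨ *-monoˡ-≤ (0≤sq r) (cs x (iterate B (2 ℕ.^ k) x)) ⟩
        r * r * (b * ⟨ iterate B (2 ℕ.^ k) x , iterate B (2 ℕ.^ k) x ⟩) ≡⟨ cong (λ u → r * r * (b * u))
            (sym (β-double (2 ℕ.^ k))) ⟩
        r * r * (b * β (2 ℕ.^ k ℕ.+ 2 ℕ.^ k)) ≡⟨ eq₃ r b _ ⟩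
        b * (r * r * β (2 ℕ.^ k ℕ.+ 2 ℕ.^ k)) ≡⟨ cong₂ (λ u v → b * (u * β v)) (sym (^-double b k))
            (cong (2 ℕ.^ k ℕ.+_) (sym (ℕ.+-identityʳ _))) ⟩
        b * (b ^ (2 ℕ.^ suc k) * β (2 ℕ.^ suc k)) ∎)
        where
        open ≤-Reasoning
        b = β 0
        s = β 1 ^ (2 ℕ.^ k)
        r = β 0 ^ (2 ℕ.^ k)
        t = β (2 ℕ.^ k)
        sq-mono : ∀ {u v} → 0ℤ ≤ u → u ≤ v → u * u ≤ v * v
        sq-mono {u} {v} h l = ≤-trans (*-monoˡ-≤ h l) (*-monoʳ-≤-nonNeg v {{nonNegative (≤-trans h l)}} l)
        eq : ∀ b s → b * (s * s * b) ≡ (s * b) * (s * b)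
        eq = solve-∀
        eq₂ : ∀ r t → (r * t) * (r * t) ≡ r * r * (t * t)
        eq₂ = solve-∀
        eq₃ : ∀ r b t → r * r * (b * t) ≡ b * (r * r * t)
        eq₃ = solve-∀

      -- An even-index `β` is the squared norm of an iterate. `poincaré` bounds it by `K` of that
      -- iterate, and `K` grows by at most `L * L` with each application of `B`.
      β-upper : ∀ k → β (2 ℕ.^ suc k) ≤ L ^ (2 ℕ.^ suc k) * (C * K x)
      β-upper k = begin
        β (2 ℕ.^ suc k)                  ≡⟨ cong (λ m → β (2 ℕ.^ k ℕ.+ m)) (ℕ.+-identityʳ _) ⟩
        β (2 ℕ.^ k ℕ.+ 2 ℕ.^ k)          ≡⟨ β-double (2 ℕ.^ k) ⟩
        ⟨ y , y ⟩                        ≤⟨ poincaré y ⟩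
        C * K y                          ≤⟨ *-monoˡ-≤ 0≤C (K-iterate x (2 ℕ.^ k)) ⟩
        C * (l * l * K x)                ≡⟨ eq C (l * l) (K x) ⟩
        l * l * (C * K x)                ≡⟨ cong (_* (C * K x)) (sym (^-double L k)) ⟩
        L ^ (2 ℕ.^ suc k) * (C * K x) ∎
        where
        open ≤-Reasoning
        y = iterate B (2 ℕ.^ k) x
        l = L ^ (2 ℕ.^ k)
        eq : ∀ a b c → a * (b * c) ≡ b * (a * c)
        eq = solve-∀

  symmetrizable-nonpositive : ∀ x → ⟨ x , A x ⟩ ≤ 0ℤ
  symmetrizable-nonpositive x with 0ℤ <? ⟨ x , A x ⟩
  ... | no ¬p = ≮⇒≥ ¬p
  ... | yes a₁>0 with 0≤⇒0⊎0< (psd x)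
  -- By Cauchy-Schwarz a vector of norm zero pairs to zero with everything.
  ...   | inj₁ a₀≡0 = contradiction (cs x (A x)) (<⇒≱ (subst (_< ⟨ x , A x ⟩ * ⟨ x , A x ⟩)
      (cong (_* ⟨ A x , A x ⟩) (sym a₀≡0)) (0<* a₁>0 a₁>0)))
  ...   | inj₂ a₀>0 = contradiction grow (exponential-dominates La₀>0 a₁>0 0≤CK)
    where
    a₀ = ⟨ x , x ⟩
    a₁ = ⟨ x , A x ⟩
    La₀>0 = 0<* L>0 a₀>0
    0≤CK : 0ℤ ≤ C * K x
    0≤CK = ≤-trans (psd x) (poincaré x)
    β1 : β x 1 ≡ L * a₀ + a₁
    β1 = B-expandʳ x x
    0≤β1 : 0ℤ ≤ β x 1
    0≤β1 = subst (0ℤ ≤_) (sym β1) (<⇒≤ (+-mono-< La₀>0 a₁>0))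
    1≤a₀ : 1ℤ ≤ a₀
    1≤a₀ = 0<⇒1≤ a₀>0
    -- The two estimates of `β x N` combined. Integrality gives `1ℤ ≤ a₀`, which supplies the extra
    -- factor in `β-lower`.
    grow : ∀ k → (L * a₀ + a₁) ^ (2 ℕ.^ suc k) ≤ (L * a₀) ^ (2 ℕ.^ suc k) * (C * K x)
    grow k = begin
      (L * a₀ + a₁) ^ N            ≡⟨ cong (_^ N) (sym β1) ⟩
      β x 1 ^ N                    ≡⟨ sym (*-identityʳ _) ⟩
      β x 1 ^ N * 1ℤ               ≤⟨ *-monoˡ-≤ (0≤^ 0≤β1 N) 1≤a₀ ⟩
      β x 1 ^ N * a₀               ≤⟨ β-lower x a₀>0 0≤β1 (suc k) ⟩
      a₀ ^ N * β x N               ≤⟨ *-monoˡ-≤ (0≤^ (<⇒≤ a₀>0) N) (β-upper x k) ⟩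
      a₀ ^ N * (L ^ N * (C * K x)) ≡⟨ eq (a₀ ^ N) (L ^ N) (C * K x) ⟩
      L ^ N * a₀ ^ N * (C * K x)   ≡⟨ cong (_* (C * K x)) (sym (^-distribʳ-* L a₀ N)) ⟩
      (L * a₀) ^ N * (C * K x)     ∎
      where
      open ≤-Reasoning
      N = 2 ℕ.^ suc k
      eq : ∀ a b c → a * (b * c) ≡ b * a * c
      eq = solve-∀

-- The Bochner method

one : ∀ {n} → Vect n
one _ = 1ℤ

-- The non-zero entries are the bases of a matroid of rank two (or there are none).
RankTwoSupport : ∀ {n} → Mat n → Set
RankTwoSupport M = ∀ {i j k l} → M i k ≢ 0ℤ → M j l ≢ 0ℤ → M i j ≢ 0ℤ ⊎ M j k ≢ 0ℤ

0≤∧≢0⇒1≤ : ∀ {a} → 0ℤ ≤ a → a ≢ 0ℤ → 1ℤ ≤ a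
0≤∧≢0⇒1≤ p q with 0≤⇒0⊎0< p
... | inj₁ r = contradiction r q
... | inj₂ r = 0<⇒1≤ r

-- Compares the ends of a path of length two through its midpoint `c`.
square-difference-≤ : ∀ a b c → (a - b) * (a - b) ≤ + 2 * ((a - c) * (a - c)) + + 2 * ((b - c) * (b - c))
square-difference-≤ a b c = ≤-from (0≤sq (a + b - + 2 * c)) (eq a b c)
  where
  eq : ∀ a b c → (a + b - + 2 * c) * (a + b - + 2 * c) ≡ + 2 * ((a - c) * (a - c)) + + 2 *
      ((b - c) * (b - c)) - (a - b) * (a - b)
  eq = solve-∀

-- The weights are already absorbed here, so `M` is the plain sum of the slices. `τ-sym` and
-- `τ-swap` together make `τ` a symmetric 3-tensor; hence `d i` is also the total of the slice
-- `τ i`.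
module LocalToGlobal {n} (τ : Fin n → Mat n)
  (τ-sym : ∀ i → Symmetric (τ i))
  (τ-swap : ∀ i a b → τ i a b ≡ τ a i b)
  (τ-0≤ : ∀ i a b → 0ℤ ≤ τ i a b)
  (τ-hyper : ∀ i → Hyper (τ i))
  where

  M : Mat n
  M a b = sum (λ i → τ i a b)

  d : Vect n
  d = rowSum M

  M-0≤ : ∀ a b → 0ℤ ≤ M a b
  M-0≤ a b = ∑-0≤ (λ i → τ-0≤ i a b)

  M-sym : Symmetric M
  M-sym a b = ∑-cong (λ i → τ-sym i a b)

  d-0≤ : ∀ i → 0ℤ ≤ d i
  d-0≤ i = ∑-0≤ (M-0≤ i)

  zero-row : ∀ {i} → d i ≡ 0ℤ → ∀ j → M i j ≡ 0ℤ
  zero-row {i} h j = ≤-antisym (≤-trans (∑-≥-term (M-0≤ i) j) (≤-reflexive h)) (M-0≤ i j)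

  zero-slice : ∀ {i} → d i ≡ 0ℤ → ∀ a b → τ i a b ≡ 0ℤ
  zero-slice {i} h a b = ≤-antisym
    (≤-trans (≤-reflexive (trans (τ-sym i a b) (τ-swap i b a)))
      (≤-trans (∑-≥-term (λ j → τ-0≤ j i a) b) (≤-reflexive (zero-row h a)))) (τ-0≤ i a b)

  app-zero : ∀ {i} → d i ≡ 0ℤ → ∀ x → app M x i ≡ 0ℤ
  app-zero h x = ∑-zero (λ j → trans (cong (_* x j) (zero-row h j)) (*-zeroˡ (x j)))

  slice-bil-one : ∀ i x → bil (τ i) x one ≡ app M x i
  slice-bil-one i x = ∑-cong (λ a → trans (*-comm (x a) (app (τ i) one a)) (cong (_* x a)
    (∑-cong (λ b → trans (*-identityʳ (τ i a b)) (trans (τ-sym i a b) (τ-swap i b a))))))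

  app-one : ∀ i → app M one i ≡ d i
  app-one i = ∑-cong (λ j → *-identityʳ (M i j))

  bil-slices : ∀ x y → sum (λ i → bil (τ i) x y) ≡ bil M x y
  bil-slices x y = trans (∑-comm (λ i a → x a * app (τ i) y a)) (∑-cong (λ a →
    trans (sym (*-distribˡ-sum (x a) (λ i → app (τ i) y a))) (cong (x a *_)
      (trans (∑-comm (λ i b → τ i a b * y b)) (∑-cong (λ b → sym (*-distribʳ-sum (y b) (λ i → τ i a b))))))))

  multiple = common-multiple d d-0≤
  L = proj₁ multiple
  L>0 = proj₁ (proj₂ multiple)
  e = proj₁ (proj₂ (proj₂ multiple))

  e-0≤ : ∀ i → 0ℤ ≤ e i
  e-0≤ i = proj₁ (proj₂ (proj₂ (proj₂ multiple)) i)

  e*d : ∀ i → 0ℤ < d i → e i * d i ≡ L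
  e*d i = proj₂ (proj₂ (proj₂ (proj₂ multiple)) i)

  -- The hypothesis on τ i applied to x and one, where τ i x one is the i-th entry of M x.
  slice-bound : ∀ x i → L * bil (τ i) x x ≤ e i * (app M x i * app M x i)
  slice-bound x i with 0≤⇒0⊎0< (d-0≤ i)
  ... | inj₁ z = ≤-trans (≤-reflexive (trans (cong (L *_) slice-zero) (*-zeroʳ L)))
      (0≤* (e-0≤ i) (0≤sq (app M x i)))
    where
    slice-zero : bil (τ i) x x ≡ 0ℤ
    slice-zero = ∑-zero (λ a → trans (cong (x a *_) (∑-zero (λ b → trans (cong (_* x b) (zero-slice z a b))
        (*-zeroˡ (x b))))) (*-zeroʳ (x a)))
  ... | inj₂ p = begin
    L * bil (τ i) x x                      ≡⟨ cong (_* bil (τ i) x x) (sym (e*d i p)) ⟩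
    e i * d i * bil (τ i) x x              ≡⟨ eq (e i) (d i) (bil (τ i) x x) ⟩
    e i * (bil (τ i) x x * d i)            ≤⟨ *-monoˡ-≤ (e-0≤ i)
        (subst₂ (λ u v → bil (τ i) x x * u ≤ v * v) one-one (slice-bil-one i x)
                                                (τ-hyper i x one (subst (0ℤ ≤_) (sym one-one) (d-0≤ i)))) ⟩
    e i * (app M x i * app M x i)          ∎
    where
    open ≤-Reasoning
    one-one : bil (τ i) one one ≡ d i
    one-one = trans (slice-bil-one i one) (app-one i)
    eq : ∀ e d q → e * d * q ≡ e * (q * d)
    eq = solve-∀

  ⟪_,_⟫ : Vect n → Vect n → ℤ
  ⟪ x , y ⟫ = sum (λ i → d i * (x i * y i))

  -- This is `D⁻¹M` scaled by `L`, with `e i` in place of `L / d i`. It is self-adjoint for `⟪_,_⟫`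
  -- because the weight `D` cancels `D⁻¹`.
  A : Vect n → Vect n
  A x i = e i * app M x i

  ⟪⟫-sym : ∀ x y → ⟪ x , y ⟫ ≡ ⟪ y , x ⟫
  ⟪⟫-sym x y = ∑-cong (λ i → cong (d i *_) (*-comm (x i) (y i)))

  -- Where `d i` vanishes the whole row of `M` does, so the value of `e i` there is harmless.
  d*A : ∀ x i c → d i * (c * A x i) ≡ L * (c * app M x i)
  d*A x i c with 0≤⇒0⊎0< (d-0≤ i)
  ... | inj₁ z = trans (cong (λ u → d i * (c * (e i * u))) (app-zero z x)) (trans (eq (d i) c (e i) L)
      (cong (λ u → L * (c * u)) (sym (app-zero z x))))
    where eq : ∀ d c e l → d * (c * (e * 0ℤ)) ≡ l * (c * 0ℤ)
          eq = solve-∀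
  ... | inj₂ p = trans (eq (d i) c (e i) (app M x i)) (cong (_* (c * app M x i)) (e*d i p))
    where eq : ∀ d c e m → d * (c * (e * m)) ≡ e * d * (c * m)
          eq = solve-∀

  ⟪⟫-A : ∀ y x → ⟪ y , A x ⟫ ≡ L * bil M y x
  ⟪⟫-A y x = trans (∑-cong (λ i → d*A x i (y i))) (sym (*-distribˡ-sum L _))

  energy : Vect n → ℤ
  energy x = sum (λ i → e i * (app M x i * app M x i))

  ⟪A,A⟫ : ∀ x → ⟪ A x , A x ⟫ ≡ L * energy x
  ⟪A,A⟫ x = trans (⟪⟫-A (A x) x) (cong (L *_) (∑-cong (λ i → *-assoc (e i) (app M x i) (app M x i))))

  -- Summing `slice-bound` over the slices; after division by `L * L` this is `T ≤ T²` for
  -- `T = D⁻¹M`.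
  square-bound : ∀ x → L * ⟪ x , A x ⟫ ≤ ⟪ A x , A x ⟫
  square-bound x = begin
    L * ⟪ x , A x ⟫                        ≡⟨ cong (L *_) (⟪⟫-A x x) ⟩
    L * (L * bil M x x)                    ≡⟨ cong (λ u → L * (L * u)) (sym (bil-slices x x)) ⟩
    L * (L * sum (λ i → bil (τ i) x x))    ≡⟨ cong (L *_) (*-distribˡ-sum L _) ⟩
    L * sum (λ i → L * bil (τ i) x x)      ≤⟨ *-monoˡ-≤ (<⇒≤ L>0) (∑-mono (slice-bound x)) ⟩
    L * energy x                           ≡⟨ sym (⟪A,A⟫ x) ⟩
    ⟪ A x , A x ⟫                          ∎
    where open ≤-Reasoning

  row-cs : ∀ x i → app M x i * app M x i ≤ d i * sum (λ j → M i j * (x j * x j))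
  row-cs x i = ≤-trans (≤-reflexive (cong (λ u → u * u)
      (∑-cong (λ j → cong (M i j *_) (sym (*-identityʳ (x j)))))))
    (≤-trans (cauchy-schwarz (M-0≤ i) x one)
    (≤-reflexive (trans (*-comm (sum (λ j → M i j * (x j * x j))) (sum (λ j → M i j * (1ℤ * 1ℤ))))
        (cong (_* sum (λ j → M i j * (x j * x j))) (∑-cong (λ j → *-identityʳ (M i j)))))))

  -- `D⁻¹M` averages with probabilities `M i j / d i`, and by Cauchy-Schwarz in each row the square
  -- of an average is at most the average of the squares. By symmetry the columns of `M` also sum to
  -- `d`.
  contraction : ∀ x → ⟪ A x , A x ⟫ ≤ L * L * ⟪ x , x ⟫
  contraction x = begin
    ⟪ A x , A x ⟫                          ≡⟨ ⟪A,A⟫ x ⟩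
    L * energy x                           ≤⟨ *-monoˡ-≤ (<⇒≤ L>0) (∑-mono term) ⟩
    L * sum (λ i → L * q i)                ≡⟨ cong (L *_) (sym (*-distribˡ-sum L q)) ⟩
    L * (L * sum q)                        ≡⟨ sym (*-assoc L L (sum q)) ⟩
    L * L * sum q                          ≡⟨ cong (L * L *_) sum-q ⟩
    L * L * ⟪ x , x ⟫                      ∎
    where
    open ≤-Reasoning
    q : Vect n
    q i = sum (λ j → M i j * (x j * x j))
    q-0≤ : ∀ i → 0ℤ ≤ q i
    q-0≤ i = ∑-0≤ (λ j → 0≤* (M-0≤ i j) (0≤sq (x j)))
    sum-q : sum q ≡ ⟪ x , x ⟫
    sum-q = trans (∑-comm (λ i j → M i j * (x j * x j))) (∑-cong (λ j →
      trans (sym (*-distribʳ-sum (x j * x j) (λ i → M i j)))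
          (cong (_* (x j * x j)) (∑-cong (λ i → M-sym i j)))))
    term : ∀ i → e i * (app M x i * app M x i) ≤ L * q i
    term i with 0≤⇒0⊎0< (d-0≤ i)
    ... | inj₁ z = ≤-trans (≤-reflexive (trans (cong (λ u → e i * (u * u)) (app-zero z x))
        (*-zeroʳ (e i)))) (0≤* (<⇒≤ L>0) (q-0≤ i))
    ... | inj₂ p = ≤-trans (*-monoˡ-≤ (e-0≤ i) (row-cs x i))
        (≤-reflexive (trans (sym (*-assoc (e i) (d i) (q i))) (cong (_* q i) (e*d i p))))

  module _ (support : RankTwoSupport M) where
    S = sum d

    S-0≤ : 0ℤ ≤ S
    S-0≤ = ∑-0≤ d-0≤

    module _ (x : Vect n) where
      D : Mat n
      D i j = M i j * ((x i - x j) * (x i - x j))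

      E : ℤ
      E = sum (λ i → sum (D i))

      D-0≤ : ∀ i j → 0ℤ ≤ D i j
      D-0≤ i j = 0≤* (M-0≤ i j) (0≤sq (x i - x j))

      E-0≤ : 0ℤ ≤ E
      E-0≤ = ∑-0≤ (λ i → ∑-0≤ (D-0≤ i))

      -- A non-zero entry of `M` is an integer, hence at least 1, so a single summand of `E` already
      -- dominates.
      edge-bound : ∀ {i j} → M i j ≢ 0ℤ → (x i - x j) * (x i - x j) ≤ E
      edge-bound {i} {j} h = ≤-trans
        (subst (_≤ D i j) (*-identityˡ _) (*-monoʳ-≤-nonNeg _ {{nonNegative (0≤sq (x i - x j))}}
            (0≤∧≢0⇒1≤ (M-0≤ i j) h)))
        (≤-trans (∑-≥-term (D-0≤ i) j) (∑-≥-term (λ k → ∑-0≤ (D-0≤ k)) i))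

      -- Rank two exchange makes two indices with non-zero rows either adjacent or joined through
      -- the neighbour `k` of `i`. In the second case each of the two edges costs `2 E`.
      pair-bound : ∀ {i j} → d i ≢ 0ℤ → d j ≢ 0ℤ → (x i - x j) * (x i - x j) ≤ + 4 * E
      pair-bound {i} {j} p q with ∑-≢0 p | ∑-≢0 q
      ... | k , r | l , s with support r s
      ...   | inj₁ t = ≤-trans (edge-bound t) (≤-from (0≤* (0≤pos 3) E-0≤) (eq E))
        where eq : ∀ e → + 3 * e ≡ + 4 * e - e
              eq = solve-∀
      ...   | inj₂ t = ≤-trans (square-difference-≤ (x i) (x j) (x k)) (≤-trans
        (+-mono-≤ (*-monoˡ-≤ (0≤pos 2) (edge-bound r)) (*-monoˡ-≤ (0≤pos 2) (edge-bound t)))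
            (≤-reflexive (eq E)))
        where eq : ∀ e → + 2 * e + + 2 * e ≡ + 4 * e
              eq = solve-∀

      weighted-pair-bound : ∀ i j → d i * d j * ((x i - x j) * (x i - x j)) ≤ d i * d j * (+ 4 * E)
      weighted-pair-bound i j with d i * d j ≟ 0ℤ
      ... | yes z = ≤-reflexive (trans (cong (_* ((x i - x j) * (x i - x j))) z)
          (trans (*-zeroˡ ((x i - x j) * (x i - x j)))
          (sym (trans (cong (_* (+ 4 * E)) z) (*-zeroˡ (+ 4 * E))))))
      ... | no z = *-monoˡ-≤ (0≤* (d-0≤ i) (d-0≤ j))
          (pair-bound (λ h → z (trans (cong (_* d j) h) (*-zeroˡ (d j))))
          (λ h → z (trans (cong (d i *_) h) (*-zeroʳ (d i)))))

      -- Apply `dirichlet` to the rank one matrix `d i * d j`: its quadratic form is the square of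
      -- `d ∙ x`, hence zero.
      variance : d ∙ x ≡ 0ℤ → sum (λ i → sum (λ j → d i * d j * ((x i - x j) * (x i - x j))))
          ≡ + 2 * (S * ⟪ x , x ⟫)
      variance h = trans (dirichlet (λ i j → *-comm (d i) (d j)) x)
          (cong (+ 2 *_) (trans (cong₂ _-_ rows cross) (+-identityʳ _)))
        where
        P : Mat n
        P i j = d i * d j
        rows : sum (λ i → rowSum P i * (x i * x i)) ≡ S * ⟪ x , x ⟫
        rows = trans (∑-cong (λ i → trans (cong (_* (x i * x i)) (trans (sym (*-distribˡ-sum (d i) d))
            (*-comm (d i) S))) (*-assoc S (d i) (x i * x i)))) (sym (*-distribˡ-sum S _))
        cross : bil P x x ≡ 0ℤ
        cross = ∑-zero (λ i → trans (cong (x i *_) (trans (∑-cong (λ j → *-assoc (d i) (d j) (x j)))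
            (trans (sym (*-distribˡ-sum (d i) _)) (trans (cong (d i *_) h) (*-zeroʳ (d i))))))
            (*-zeroʳ (x i)))

      -- The spectral gap below the top eigenvalue. The variance weighs squared differences over all
      -- pairs, each at most `4 E`, while `E` is twice `⟪ x , x ⟫ - bil M x x`; cancelling `2 S`
      -- leaves the constant `4 S`.
      poincaré : d ∙ x ≡ 0ℤ → ⟪ x , x ⟫ ≤ + 4 * S * (L * ⟪ x , x ⟫ - ⟪ x , A x ⟫)
      poincaré h with 0≤⇒0⊎0< S-0≤
      ... | inj₁ z = ≤-reflexive (trans (∑-zero (λ i → trans (cong (_* (x i * x i)) (d-zero i))
          (*-zeroˡ (x i * x i)))) (sym (cong (λ s → + 4 * s * K) z)))
        where
        K = L * ⟪ x , x ⟫ - ⟪ x , A x ⟫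
        d-zero : ∀ i → d i ≡ 0ℤ
        d-zero i = ≤-antisym (≤-trans (∑-≥-term d-0≤ i) (≤-reflexive z)) (d-0≤ i)
      ... | inj₂ S>0 = *-cancelˡ-≤ {c = + 2 * S} (0<* {+ 2} {S} (+<+ (s≤s z≤n)) S>0) (begin
        + 2 * S * ⟪ x , x ⟫                      ≡⟨ *-assoc (+ 2) S ⟪ x , x ⟫ ⟩
        + 2 * (S * ⟪ x , x ⟫)                    ≡⟨ sym (variance h) ⟩
        sum (λ i → sum (λ j → d i * d j * ((x i - x j) * (x i - x j))))
            ≤⟨ ∑-mono (λ i → ∑-mono (weighted-pair-bound i)) ⟩
        sum (λ i → sum (λ j → d i * d j * (+ 4 * E)))
            ≡⟨ ∑-cong (λ i → sym (*-distribʳ-sum (+ 4 * E) (λ j → d i * d j))) ⟩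
        sum (λ i → sum (λ j → d i * d j) * (+ 4 * E)) ≡⟨ sym (*-distribʳ-sum (+ 4 * E) _) ⟩
        sum (λ i → sum (λ j → d i * d j)) * (+ 4 * E) ≡⟨ cong (_* (+ 4 * E)) (∑-prod d d) ⟩
        -- The factor `L ≥ 1` is inserted to match the scaling of `A`.
        S * S * (+ 4 * E)                        ≤⟨ *-monoˡ-≤ (0≤* S-0≤ S-0≤) (*-monoˡ-≤ (0≤pos 4) E≤LE) ⟩
        S * S * (+ 4 * (L * E))                  ≡⟨ cong (λ u → S * S * (+ 4 * (L * u))) (dirichlet M-sym x) ⟩
        S * S * (+ 4 * (L * (+ 2 * (⟪ x , x ⟫ - bil M x x)))) ≡⟨ eq S L ⟪ x , x ⟫ (bil M x x) ⟩
        + 2 * S * (+ 4 * S * (L * ⟪ x , x ⟫ - L * bil M x x))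
            ≡⟨ cong (λ u → + 2 * S * (+ 4 * S * (L * ⟪ x , x ⟫ - u))) (sym (⟪⟫-A x x)) ⟩
        + 2 * S * (+ 4 * S * (L * ⟪ x , x ⟫ - ⟪ x , A x ⟫)) ∎)
        where
        open ≤-Reasoning
        E≤LE : E ≤ L * E
        E≤LE = subst (_≤ L * E) (*-identityˡ E) (*-monoʳ-≤-nonNeg E {{nonNegative E-0≤}} (0<⇒1≤ L>0))
        eq : ∀ s l x b → s * s * (+ 4 * (l * (+ 2 * (x - b)))) ≡ + 2 * s * (+ 4 * s * (l * x - l * b))
        eq = solve-∀

    -- The complement of `one`, since `d ∙ x` is `⟪ one , x ⟫`. Bundling the condition lets
    -- `poincaré` hold on the whole carrier, as the abstract spectral argument demands.
    V : Set
    V = Σ[ x ∈ Vect n ] d ∙ x ≡ 0ℤ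

    d∙A : ∀ x → d ∙ x ≡ 0ℤ → d ∙ A x ≡ 0ℤ
    d∙A x h = trans (∑-cong (λ i → cong (d i *_) (sym (*-identityˡ (A x i))))) (trans (⟪⟫-A one x)
      (trans (cong (L *_) (trans (bil-sym M-sym one x) (trans (∑-cong (λ i → cong (x i *_) (app-one i)))
          (trans (∙-comm x d) h)))) (*-zeroʳ L)))

    AV BV : V → V
    AV (x , h) = A x , d∙A x h
    BV (x , h) = lin L x 1ℤ (A x) , trans (∙-linʳ d L x 1ℤ (A x))
        (trans (cong₂ (λ u v → L * u + 1ℤ * v) h (d∙A x h)) (trans (+-identityʳ (L * 0ℤ)) (*-zeroʳ L)))

    B-expand : ∀ x y → ⟪ lin L x 1ℤ (A x) , y ⟫ ≡ L * ⟪ x , y ⟫ + ⟪ A x , y ⟫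
    B-expand x y = trans (∑-cong (λ i → eq (d i) L (x i) (A x i) (y i)))
        (trans (∑-lin L 1ℤ (λ i → d i * (x i * y i)) (λ i → d i * (A x i * y i)))
      (cong (_+_ (L * ⟪ x , y ⟫)) (*-identityˡ ⟪ A x , y ⟫)))
      where
      eq : ∀ d l x a y → d * ((l * x + 1ℤ * a) * y) ≡ l * (d * (x * y)) + 1ℤ * (d * (a * y))
      eq = solve-∀

    nonpositive : ∀ x → d ∙ x ≡ 0ℤ → bil M x x ≤ 0ℤ
    nonpositive x h = *-cancelˡ-≤ L>0 (≤-trans (≤-reflexive (sym (⟪⟫-A x x)))
      (≤-trans (symmetrizable-nonpositive (λ { (u , _) (v , _) → ⟪ u , v ⟫ }) AV BV L (+ 4 * S) L>0
          (0≤* (0≤pos 4) S-0≤)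
        (λ { (u , _) (v , _) → ⟪⟫-sym u v })
        (λ { (u , _) (v , _) → trans (⟪⟫-sym (A u) v)
            (trans (⟪⟫-A v u) (trans (cong (L *_) (bil-sym M-sym v u)) (sym (⟪⟫-A u v)))) })
        (λ { (u , _) (v , _) → B-expand u v })
        (λ { (u , _) → ∑-0≤ (λ i → 0≤* (d-0≤ i) (0≤sq (u i))) })
        (λ { (u , _) (v , _) → cauchy-schwarz d-0≤ u v })
        (λ { (u , _) → square-bound u })
        (λ { (u , _) → contraction u })
        (λ { (u , p) → poincaré u p })
        (x , h)) (≤-reflexive (sym (*-zeroʳ L)))))

    hyper : Hyper M
    hyper = hyper-from-functional M-sym d nonpositive

hyper-sum : ∀ {n} (τ : Fin n → Mat n) → (∀ i → Symmetric (τ i)) → (∀ i a b → τ i a b ≡ τ a i b) →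
  (∀ i a b → 0ℤ ≤ τ i a b) → (∀ i → Hyper (τ i)) →
  RankTwoSupport (λ a b → sum (λ i → τ i a b)) → Hyper (λ a b → sum (λ i → τ i a b))
hyper-sum τ s t p h = LocalToGlobal.hyper τ s t p h

-- Operations that preserve `Hyper`

bil-cong : ∀ {n} {M N : Mat n} → (∀ i j → M i j ≡ N i j) → ∀ x y → bil M x y ≡ bil N x y
bil-cong h x y = ∑-cong (λ i → cong (x i *_) (∑-cong (λ j → cong (_* y j) (h i j))))

hyper-cong : ∀ {n} (M N : Mat n) → (∀ i j → M i j ≡ N i j) → Hyper M → Hyper N
hyper-cong M N h H x y p = subst₂ _≤_ (cong₂ _*_ (bil-cong {M = M} {N} h x x) (bil-cong {M = M} {N} h y y))
    (cong (λ u → u * u) (bil-cong {M = M} {N} h x y))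
  (H x y (subst (0ℤ ≤_) (sym (bil-cong {M = M} {N} h y y)) p))

-- Both sides of the inequality are quadratic in the form, so positive factors cancel. Having one on
-- each side accommodates substitutions with cleared denominators.
hyper-pullback : ∀ {m n} (P : Mat m) (Q : Mat n) {a b} (f : Vect m → Vect n) → 0ℤ < a → 0ℤ < b →
  (∀ x y → a * bil P x y ≡ b * bil Q (f x) (f y)) → Hyper Q → Hyper P
hyper-pullback P Q {a} {b} f a>0 b>0 h H x y 0≤yy = *-cancelˡ-≤ (0<* a>0 a>0) (begin
  a * a * (bil P x x * bil P y y)      ≡⟨ eq a (bil P x x) (bil P y y) ⟩
  a * bil P x x * (a * bil P y y)      ≡⟨ cong₂ _*_ (h x x) (h y y) ⟩
  b * Qxx * (b * Qyy)                  ≡⟨ sym (eq b Qxx Qyy) ⟩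
  b * b * (Qxx * Qyy)                  ≤⟨ *-monoˡ-≤ (0≤sq b) (H (f x) (f y) 0≤Qyy) ⟩
  b * b * (Qxy * Qxy)                  ≡⟨ eq b Qxy Qxy ⟩
  b * Qxy * (b * Qxy)                  ≡⟨ cong (λ u → u * u) (sym (h x y)) ⟩
  a * bil P x y * (a * bil P x y)      ≡⟨ sym (eq a (bil P x y) (bil P x y)) ⟩
  a * a * (bil P x y * bil P x y)      ∎)
  where
  open ≤-Reasoning
  Qxx = bil Q (f x) (f x)
  Qxy = bil Q (f x) (f y)
  Qyy = bil Q (f y) (f y)
  eq : ∀ a p q → a * a * (p * q) ≡ a * p * (a * q)
  eq = solve-∀
  0≤Qyy : 0ℤ ≤ Qyy
  0≤Qyy = *-cancelˡ-≤ b>0 (subst₂ _≤_ (sym (*-zeroʳ b)) (h y y) (0≤* (<⇒≤ a>0) 0≤yy))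

rescale : ∀ {n} → Vect n → Vect n → Vect n
rescale w x i = w i * x i

weighted : ∀ {n} → Vect n → Mat n → Mat n
weighted w N a b = w a * (w b * N a b)

bil-weighted : ∀ {n} (w : Vect n) (N : Mat n) x y → bil (weighted w N) x y ≡ bil N (rescale w x) (rescale w y)
bil-weighted w N x y = ∑-cong λ a → begin
  x a * sum (λ b → w a * (w b * N a b) * y b)      ≡⟨ cong (x a *_) (∑-cong λ b → eq (w a) (w b) (N a b)
      (y b)) ⟩
  x a * sum (λ b → w a * (N a b * (w b * y b)))    ≡⟨ cong (x a *_)
      (sym (*-distribˡ-sum (w a) (λ b → N a b * (w b * y b)))) ⟩
  x a * (w a * app N (rescale w y) a)              ≡⟨ eq₂ (x a) (w a) (app N (rescale w y) a) ⟩
  w a * x a * app N (rescale w y) a                ∎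
  where
  open ≡-Reasoning
  eq : ∀ a b p y → a * (b * p) * y ≡ a * (p * (b * y))
  eq = solve-∀
  eq₂ : ∀ x a p → x * (a * p) ≡ a * x * p
  eq₂ = solve-∀

hyper-scale : ∀ {n} (N : Mat n) {c} → 0ℤ < c → Hyper N → Hyper (λ a b → c * N a b)
hyper-scale N {c} c>0 = hyper-pullback (λ a b → c * N a b) N (λ x → x) 0<1 c>0 λ x y →
  trans (*-identityˡ (bil (λ a b → c * N a b) x y)) (begin
  sum (λ a → x a * sum (λ b → c * N a b * y b))    ≡⟨ ∑-cong
      (λ a → cong (x a *_) (∑-cong λ b → *-assoc c (N a b) (y b))) ⟩
  sum (λ a → x a * sum (λ b → c * (N a b * y b)))  ≡⟨ ∑-cong
      (λ a → cong (x a *_) (sym (*-distribˡ-sum c (λ b → N a b * y b)))) ⟩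
  sum (λ a → x a * (c * app N y a))                ≡⟨ ∑-cong (λ a → eq (x a) c (app N y a)) ⟩
  sum (λ a → c * (x a * app N y a))                ≡⟨ sym (*-distribˡ-sum c (λ a → x a * app N y a)) ⟩
  c * bil N x y                                    ∎)
  where
  open ≡-Reasoning
  eq : ∀ x c p → x * (c * p) ≡ c * (x * p)
  eq = solve-∀

hyper-weighted : ∀ {n} (w : Vect n) (N : Mat n) → Hyper N → Hyper (weighted w N)
hyper-weighted w N = hyper-pullback (weighted w N) N (rescale w) 0<1 0<1 λ x y →
  cong (1ℤ *_) (bil-weighted w N x y)

-- With `e` in the role of `L / w`, substituting `rescale e` undoes the weights up to the factor
-- `L * L`.
hyper-unweighted : ∀ {n} (w : Vect n) → (∀ i → 0ℤ < w i) → (N : Mat n) → Hyper (weighted w N) → Hyper N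
hyper-unweighted {n} w w>0 N = unweighted (common-multiple w (λ i → <⇒≤ (w>0 i)))
  where
  unweighted : (∃ λ L → 0ℤ < L × ∃ λ (e : Vect n) → ∀ i → 0ℤ ≤ e i × (0ℤ < w i → e i * w i ≡ L)) →
    Hyper (weighted w N) → Hyper N
  unweighted (L , L>0 , e , p) = hyper-pullback N (weighted w N) (rescale e) (0<* L>0 L>0) 0<1 λ x y
      → sym (begin
    1ℤ * bil (weighted w N) (rescale e x) (rescale e y)          ≡⟨ *-identityˡ _ ⟩
    bil (weighted w N) (rescale e x) (rescale e y)               ≡⟨ bil-weighted w N (rescale e x)
        (rescale e y) ⟩
    bil N (rescale w (rescale e x)) (rescale w (rescale e y))    ≡⟨ ∑-cong (λ a → cong₂ _*_ (undo x a)
        (∑-cong λ b → cong (N a b *_) (undo y b))) ⟩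
    bil N (λ a → L * x a) (λ b → L * y b)
        ≡⟨ ∑-cong (λ a → cong (L * x a *_) (trans (∑-cong λ b → eq₁ (N a b) L (y b))
        (sym (*-distribˡ-sum L (λ b → N a b * y b))))) ⟩
    sum (λ a → L * x a * (L * app N y a))                        ≡⟨ ∑-cong (λ a → eq₂ L (x a) (app N y a)) ⟩
    sum (λ a → L * L * (x a * app N y a))
        ≡⟨ sym (*-distribˡ-sum (L * L) (λ a → x a * app N y a)) ⟩
    L * L * bil N x y                                            ∎)
    where
    open ≡-Reasoning
    undo : ∀ x a → w a * (e a * x a) ≡ L * x a
    undo x a = trans (eq (w a) (e a) (x a)) (cong (_* x a) (proj₂ (p a) (w>0 a)))
      where
      eq : ∀ w e x → w * (e * x) ≡ e * w * x
      eq = solve-∀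
    eq₁ : ∀ a l y → a * (l * y) ≡ l * (a * y)
    eq₁ = solve-∀
    eq₂ : ∀ l x p → l * x * (l * p) ≡ l * l * (x * p)
    eq₂ = solve-∀

-- Contractions of matroidal tensors

module _ {n : ℕ} where

  Tensor : Set
  Tensor = List (Fin n) → ℤ

  slice : Fin n → Tensor → Tensor
  slice i φ l = φ (i ∷ l)

  avg : Vect n → Tensor → Tensor
  avg w φ l = sum (λ i → w i * φ (i ∷ l))

  avgs : List (Vect n) → Tensor → Tensor
  avgs ws φ = foldr avg φ ws

  mat : Tensor → Mat n
  mat φ i j = φ (i ∷ j ∷ [])

  -- The support of φ consists of the ordered bases of a matroid, whose rank is not
  -- recorded.
  record Matroidal (φ : Tensor) : Set where
    field
      perm     : ∀ {xs ys} → xs ↭ ys → φ xs ≡ φ ys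
      repeat-0 : ∀ c l → φ (c ∷ c ∷ l) ≡ 0ℤ
      0≤       : ∀ l → 0ℤ ≤ φ l
      exchange : ∀ {a as bs} → φ (a ∷ as) ≢ 0ℤ → φ bs ≢ 0ℤ → ∃ λ b → b ∈ bs × φ (b ∷ as) ≢ 0ℤ

    swap₂ : ∀ a b l → φ (a ∷ b ∷ l) ≡ φ (b ∷ a ∷ l)
    swap₂ a b l = perm (swap a b refl)

  open Matroidal

  NonNegative-vec : Vect n → Set
  NonNegative-vec w = ∀ i → 0ℤ ≤ w i

  slice-matroidal : ∀ {φ} → Matroidal φ → ∀ i → Matroidal (slice i φ)
  slice-matroidal {φ} m i .perm p = perm m (prep i p)
  slice-matroidal {φ} m i .repeat-0 c l = trans (perm m (↭-trans (swap i c refl) (prep c (swap i c refl))))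
      (repeat-0 m c (i ∷ l))
  slice-matroidal {φ} m i .0≤ l = 0≤ m (i ∷ l)
  slice-matroidal {φ} m i .exchange {a} {as} p q with exchange m (p ∘ trans (swap₂ m i a as)) q
  ... | b , here refl , r = contradiction (repeat-0 m i as) r
  ... | b , there b∈ , r = b , b∈ , r ∘ trans (swap₂ m b i as)

  avg-≢0 : ∀ {w φ l} → avg w φ l ≢ 0ℤ → ∃ λ t → w t ≢ 0ℤ × φ (t ∷ l) ≢ 0ℤ
  avg-≢0 {w} {φ} {l} h with ∑-≢0 h
  ... | t , q = t , (λ z → q (trans (cong (_* φ (t ∷ l)) z) (*-zeroˡ (φ (t ∷ l))))) ,
      (λ z → q (trans (cong (w t *_) z) (*-zeroʳ (w t))))

  *-≢0 : ∀ {a b} → a ≢ 0ℤ → b ≢ 0ℤ → a * b ≢ 0ℤ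
  *-≢0 {a} p q h with i*j≡0⇒i≡0∨j≡0 a h
  ... | inj₁ r = p r
  ... | inj₂ r = q r

  -- Non-negative terms cannot cancel.
  avg-≢0⁺ : ∀ {w φ} → NonNegative-vec w → Matroidal φ → ∀ {l} t → w t ≢ 0ℤ → φ (t ∷ l) ≢ 0ℤ → avg w φ l ≢ 0ℤ
  avg-≢0⁺ {w} {φ} w≥0 m {l} t p q h = *-≢0 p q (≤-antisym
      (≤-trans (∑-≥-term {f = λ i → w i * φ (i ∷ l)} (λ i → 0≤* (w≥0 i) (0≤ m (i ∷ l))) t) (≤-reflexive h))
      (0≤* (w≥0 t) (0≤ m (t ∷ l))))

  -- When the average is non-zero, its support comes from adjoining a generic element of the span of
  -- the support of `w` and contracting it.
  avg-matroidal : ∀ {w φ} → NonNegative-vec w → Matroidal φ → Matroidal (avg w φ)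
  avg-matroidal {w} {φ} w≥0 m .perm p = ∑-cong (λ i → cong (w i *_) (perm m (prep i p)))
  avg-matroidal {w} {φ} w≥0 m .repeat-0 c l = ∑-zero
      (λ i → trans (cong (w i *_) (repeat-0 (slice-matroidal m i) c l)) (*-zeroʳ (w i)))
  avg-matroidal {w} {φ} w≥0 m .0≤ l = ∑-0≤ (λ i → 0≤* (w≥0 i) (0≤ m (i ∷ l)))
  avg-matroidal {w} {φ} w≥0 m .exchange {a} {as} {bs} p q
    with t , wt , φt ← avg-≢0 {w} {φ} p | t′ , wt′ , φt′ ← avg-≢0 {w} {φ} q
    with exchange m (φt ∘ trans (swap₂ m t a as)) φt′
  ... | b , there b∈ , r = b , b∈ , avg-≢0⁺ w≥0 m t wt (r ∘ trans (swap₂ m b t as))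
  -- The exchange returned the contracted element `t′` itself. Now `t′` is contracted instead of
  -- `t`: exchanging `t` out of `t ∷ t′ ∷ as` must give an element of `bs`, as a second `t′` would
  -- be a repetition.
  ... | _ , here refl , r with exchange m (r ∘ trans (swap₂ m t′ t as)) φt′
  ...   | b , there b∈ , s = b , b∈ , avg-≢0⁺ w≥0 m t′ wt′ (s ∘ trans (swap₂ m b t′ as))
  ...   | _ , here refl , s = contradiction (repeat-0 m t′ as) s

  avgs-matroidal : ∀ {ws φ} → All NonNegative-vec ws → Matroidal φ → Matroidal (avgs ws φ)
  avgs-matroidal [] m = m
  avgs-matroidal (p ∷ ps) m = avg-matroidal p (avgs-matroidal ps m)

  avg-cong : ∀ w {φ ψ} → φ ≗ ψ → avg w φ ≗ avg w ψ
  avg-cong w h l = ∑-cong (λ i → cong (w i *_) (h (i ∷ l)))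

  avgs-slice : ∀ {ws φ} → All NonNegative-vec ws → Matroidal φ → ∀ i → avgs ws (slice i φ) ≗ slice i
      (avgs ws φ)
  avgs-slice [] m i l = refl
  avgs-slice {w ∷ ws} {φ} (p ∷ ps) m i l = trans (avg-cong w (avgs-slice ps m i) l)
    (∑-cong (λ j → cong (w j *_) (swap₂ (avgs-matroidal ps m) i j l)))

  mat-sym : ∀ {φ} → Matroidal φ → Symmetric (mat φ)
  mat-sym m i j = swap₂ m i j []

  -- The element `l` of the basis `j`, `l` is exchanged for `i` or `k`.
  mat-support : ∀ {φ} → Matroidal φ → RankTwoSupport (mat φ)
  mat-support m {i} {j} {k} {l} p q with exchange m (q ∘ trans (swap₂ m j l [])) p
  ... | _ , here refl , r = inj₁ r
  ... | _ , there (here refl) , r = inj₂ (r ∘ trans (swap₂ m k j []))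

  -- Weighting all three slots by `w` keeps the tensor symmetric and turns the average into a plain
  -- sum, to which `hyper-sum` applies. The result is `weighted w N`, and positivity of `w` allows
  -- the weights to be removed.
  hyper-avg-positive : ∀ {ψ} → Matroidal ψ → (∀ i → Hyper (mat (slice i ψ))) →
    ∀ w → (∀ i → 0ℤ < w i) → Hyper (mat (avg w ψ))
  hyper-avg-positive {ψ} m H w w>0 = hyper-unweighted w w>0 N (hyper-cong M (weighted w N) M≡
      (hyper-sum τ τ-sym τ-swap τ-0≤ τ-hyper support))
    where
    τ : Fin n → Mat n
    τ i = weighted w (λ a b → w i * ψ (i ∷ a ∷ b ∷ []))
    M N : Mat n
    M a b = sum (λ i → τ i a b)
    N = mat (avg w ψ)
    τ-hyper : ∀ i → Hyper (τ i)
    τ-hyper i = hyper-weighted w (λ a b → w i * ψ (i ∷ a ∷ b ∷ [])) (hyper-scale (mat (slice i ψ)) (w>0 i)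
        (H i))
    eq : ∀ i a b p → i * (a * (b * p)) ≡ a * (i * (b * p))
    eq = solve-∀
    eq₂ : ∀ i a b p → a * (b * (i * p)) ≡ i * (b * (a * p))
    eq₂ = solve-∀
    τ-sym : ∀ i → Symmetric (τ i)
    τ-sym i a b = trans (cong (λ u → w a * (w b * (w i * u))) (perm m (prep i (swap a b refl))))
        (eq (w a) (w b) (w i) (ψ (i ∷ b ∷ a ∷ [])))
    τ-swap : ∀ i a b → τ i a b ≡ τ a i b
    τ-swap i a b = trans (cong (λ u → w a * (w b * (w i * u))) (swap₂ m i a (b ∷ [])))
        (eq₂ (w i) (w a) (w b) (ψ (a ∷ i ∷ b ∷ [])))
    w≥0 : NonNegative-vec w
    w≥0 i = <⇒≤ (w>0 i)
    τ-0≤ : ∀ i a b → 0ℤ ≤ τ i a b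
    τ-0≤ i a b = 0≤* {w a} {w b * (w i * ψ (i ∷ a ∷ b ∷ []))} (w≥0 a) (0≤* {w b} {w i * ψ (i ∷ a ∷ b ∷ [])}
        (w≥0 b) (0≤* {w i} {ψ (i ∷ a ∷ b ∷ [])} (w≥0 i) (0≤ m (i ∷ a ∷ b ∷ []))))
    M≡ : ∀ a b → M a b ≡ weighted w N a b
    M≡ a b = trans (sym (*-distribˡ-sum (w a) (λ i → w b * (w i * ψ (i ∷ a ∷ b ∷ [])))))
        (cong (w a *_) (sym (*-distribˡ-sum (w b) (λ i → w i * ψ (i ∷ a ∷ b ∷ [])))))
    M⇒N : ∀ {a b} → M a b ≢ 0ℤ → N a b ≢ 0ℤ
    M⇒N {a} {b} h z = h (trans (M≡ a b) (trans (cong (λ u → w a * (w b * u)) z)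
        (trans (cong (w a *_) (*-zeroʳ (w b))) (*-zeroʳ (w a)))))
    w≢0 : ∀ i → w i ≢ 0ℤ
    w≢0 i z = <-irrefl (sym z) (w>0 i)
    N⇒M : ∀ {a b} → N a b ≢ 0ℤ → M a b ≢ 0ℤ
    N⇒M {a} {b} h z = *-≢0 {w a} {w b * N a b} (w≢0 a) (*-≢0 {w b} {N a b} (w≢0 b) h) (trans (sym (M≡ a b)) z)
    support : RankTwoSupport M
    support {i} {j} {k} {l} p q with mat-support (avg-matroidal w≥0 m) {i} {j} {k} {l} (M⇒N p) (M⇒N q)
    ... | inj₁ r = inj₁ (N⇒M r)
    ... | inj₂ r = inj₂ (N⇒M r)

-- Passage to the limit

eventually-quadratic-≥0 : ∀ {a b c} N₀ → (∀ N → N₀ ℕ.≤ N → 0ℤ ≤ + N * + N * a + + N * b + c) → 0ℤ ≤ a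
eventually-quadratic-≥0 {a} {b} {c} N₀ h with 0ℤ ≤? a
... | yes p = p
... | no ¬p = contradiction (h N N₀≤N) (<⇒≱ (negative (+ N) (i≤∣i∣ b) (i≤∣i∣ c) (0≤pos ∣ c ∣) 0<N large))
  where
  -- If `a ≤ - 1`, the leading term is at most `- N * N` and outweighs the others at this `N`; the
  -- summand `N₀` keeps `N` in the admissible range.
  N = suc (∣ b ∣ ℕ.+ ∣ c ∣ ℕ.+ N₀)
  N₀≤N : N₀ ℕ.≤ N
  N₀≤N = ℕ.≤-trans (ℕ.m≤n+m N₀ (∣ b ∣ ℕ.+ ∣ c ∣)) (ℕ.n≤1+n _)
  0<N : 0ℤ < + N
  0<N = +<+ (s≤s z≤n)
  large : 1ℤ + (+ ∣ b ∣ + + ∣ c ∣) ≤ + N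
  large = +≤+ (s≤s (ℕ.m≤m+n (∣ b ∣ ℕ.+ ∣ c ∣) N₀))
  i≤∣i∣ : ∀ i → i ≤ + ∣ i ∣
  i≤∣i∣ (+ n) = ≤-refl
  i≤∣i∣ -[1+ n ] = -≤+
  eq : ∀ M B C → M * M * (- 1ℤ) + M * B + M * C ≡ M * (B + C - M)
  eq = solve-∀
  eq₂ : ∀ M B C → M - (1ℤ + (B + C)) ≡ - 1ℤ - (B + C - M)
  eq₂ = solve-∀
  a≤-1 : a ≤ - 1ℤ
  a≤-1 = i<j⇒i≤pred[j] (≰⇒> ¬p)
  negative : ∀ M {B C} → b ≤ B → c ≤ C → 0ℤ ≤ C → 0ℤ < M → 1ℤ + (B + C) ≤ M → M * M * a + M * b + c < 0ℤ
  negative M {B} {C} b≤B c≤C 0≤C 0<M l = begin-strict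
    M * M * a + M * b + c
      ≤⟨ +-mono-≤ (+-mono-≤ (*-monoˡ-≤ (0≤sq M) a≤-1) (*-monoˡ-≤ (<⇒≤ 0<M) b≤B))
           (≤-trans c≤C (subst (_≤ M * C) (*-identityˡ C)
             (*-monoʳ-≤-nonNeg C {{nonNegative 0≤C}} (0<⇒1≤ 0<M)))) ⟩
    M * M * (- 1ℤ) + M * B + M * C    ≡⟨ eq M B C ⟩
    M * (B + C - M)                   ≤⟨ *-monoˡ-≤ (<⇒≤ 0<M) (≤-from (i≤j⇒0≤j-i l) (eq₂ M B C)) ⟩
    M * (- 1ℤ)                        <⟨ *-monoˡ-<-pos M {{positive 0<M}} -<+ ⟩
    M * 0ℤ                            ≡⟨ *-zeroʳ M ⟩
    0ℤ                                ∎
    where open ≤-Reasoning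

-- The inequality for `k M + N` is quadratic in `k` with leading coefficient `r * r - p * q`, which
-- must therefore be non-negative. The sign hypothesis holds once `k ≥ ∣ q′ ∣`, because a positive
-- `q` is at least 1; for `q = 0` the claim is immediate.
hyper-limit : ∀ {n} {M N : Mat n} → (∀ (k : ℕ) → Hyper (λ i j → + k * M i j + N i j)) → Hyper M
hyper-limit {n} {M} {N} H x y 0≤yy with 0≤⇒0⊎0< 0≤yy
... | inj₁ z = ≤-trans (≤-reflexive (trans (cong (bil M x x *_) z) (*-zeroʳ (bil M x x)))) (0≤sq (bil M x y))
... | inj₂ q>0 = 0≤i-j⇒j≤i (eventually-quadratic-≥0 ∣ q′ ∣ poly)
  where
  p = bil M x x
  q = bil M y y
  r = bil M x y
  p′ = bil N x x
  q′ = bil N y y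
  r′ = bil N x y
  expand : ∀ k u v → bil (λ i j → + k * M i j + N i j) u v ≡ + k * bil M u v + bil N u v
  expand k u v = trans (∑-cong (λ i → trans (cong (u i *_)
      (trans (∑-cong (λ j → eq (+ k) (M i j) (N i j) (v j))) (∑-lin (+ k) 1ℤ (λ j → M i j * v j)
      (λ j → N i j * v j))))
      (eq₂ (+ k) (u i) (app M v i) (app N v i)))) (trans (∑-lin (+ k) 1ℤ (λ i → u i * app M v i)
          (λ i → u i * app N v i)) (cong (_+_ (+ k * bil M u v)) (*-identityˡ (bil N u v))))
    where
    eq : ∀ k m n v → (k * m + n) * v ≡ k * (m * v) + 1ℤ * (n * v)
    eq = solve-∀
    eq₂ : ∀ k u m n → u * (k * m + 1ℤ * n) ≡ k * (u * m) + 1ℤ * (u * n)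
    eq₂ = solve-∀
  poly : ∀ k → ∣ q′ ∣ ℕ.≤ k → 0ℤ ≤ + k * + k * (r * r - p * q) + + k * (+ 2 * (r * r′) - p * q′ - p′ * q) +
      (r′ * r′ - p′ * q′)
  poly k h = subst (0ℤ ≤_) (eq (+ k) p q r p′ q′ r′)
      (i≤j⇒0≤j-i (subst₂ _≤_ (cong₂ _*_ (expand k x x) (expand k y y)) (cong (λ u → u * u) (expand k x y))
    (H k x y (subst (0ℤ ≤_) (sym (expand k y y)) kq≥0))))
    where
    eq : ∀ k p q r p′ q′ r′ → (k * r + r′) * (k * r + r′) - (k * p + p′) * (k * q + q′)
        ≡ k * k * (r * r - p * q) + k * (+ 2 * (r * r′) - p * q′ - p′ * q) + (r′ * r′ - p′ * q′)
    eq = solve-∀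
    -i≤∣i∣ : ∀ i → 0ℤ ≤ + ∣ i ∣ + i
    -i≤∣i∣ (+ n) = 0≤pos _
    -i≤∣i∣ -[1+ n ] = ≤-reflexive (sym (+-inverseʳ (+ suc n)))
    eq₃ : ∀ k q q′ m → k * (q - 1ℤ) + (k - m) + (m + q′) ≡ k * q + q′
    eq₃ = solve-∀
    kq≥0 : 0ℤ ≤ + k * q + q′
    kq≥0 = subst (0ℤ ≤_) (eq₃ (+ k) q q′ (+ ∣ q′ ∣)) (0≤+ (0≤+ (0≤* (0≤pos k) (i≤j⇒0≤j-i (0<⇒1≤ q>0)))
        (i≤j⇒0≤j-i (+≤+ h))) (-i≤∣i∣ q′))

hyper-avg : ∀ {n} {ψ : Tensor {n}} → Matroidal ψ → (∀ i → Hyper (mat (slice i ψ))) →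
  ∀ w → NonNegative-vec w → Hyper (mat (avg w ψ))
hyper-avg {n} {ψ} m H w w≥0 = hyper-limit {M = mat (avg w ψ)} {N = mat (avg one ψ)}
    (λ k → hyper-cong (mat (avg (lin (+ k) w 1ℤ one) ψ))
      (λ i j → + k * mat (avg w ψ) i j + mat (avg one ψ) i j) (split k)
  (hyper-avg-positive m H (lin (+ k) w 1ℤ one) (λ i → +-mono-≤-< (0≤* (0≤pos k) (w≥0 i)) 0<1)))
  where
  split : ∀ k i j → mat (avg (lin (+ k) w 1ℤ one) ψ) i j ≡ + k * mat (avg w ψ) i j + mat (avg one ψ) i j
  split k i j = trans (∙-linˡ (λ t → ψ (t ∷ i ∷ j ∷ [])) (+ k) w 1ℤ one)
      (cong (λ u → + k * mat (avg w ψ) i j + u) (*-identityˡ (mat (avg one ψ) i j)))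

-- Rank two

ZeroOne : ℤ → Set
ZeroOne a = a ≡ 0ℤ ⊎ a ≡ 1ℤ

≢0⇒≡1 : ∀ {a} → ZeroOne a → a ≢ 0ℤ → a ≡ 1ℤ
≢0⇒≡1 (inj₁ p) q = contradiction p q
≢0⇒≡1 (inj₂ p) _ = p

-- An equivalence relation on part of the index set; indices outside it have zero rows. This class
-- of matrices is stable under removing a class, which leaves zero rows behind.
record PartialEquivalence {n} (K : Mat n) : Set where
  field
    zero-one   : ∀ i j → ZeroOne (K i j)
    symmetric  : Symmetric K
    transitive : ∀ i j k → K i j ≢ 0ℤ → K j k ≢ 0ℤ → K i k ≢ 0ℤ

open PartialEquivalence

-- Removing the class of the first index is a Schur complement.
removeClass : ∀ {n} → Mat (suc n) → Mat n
removeClass K i j = K (suc i) (suc j) - K zero (suc i) * K zero (suc j)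

removeClass-in : ∀ {n} {K : Mat (suc n)} → PartialEquivalence K → ∀ i j → K zero (suc i) ≢ 0ℤ
    → removeClass K i j ≡ 0ℤ
removeClass-in {K = K} E i j p with K zero (suc j) ≟ 0ℤ
... | yes q rewrite q | *-zeroʳ (K zero (suc i)) with K (suc i) (suc j) ≟ 0ℤ
...   | yes r = cong (_- 0ℤ) r
...   | no r = contradiction q (transitive E zero (suc i) (suc j) p r)
removeClass-in {K = K} E i j p | no q
  rewrite ≢0⇒≡1 (zero-one E zero (suc i)) p | ≢0⇒≡1 (zero-one E zero (suc j)) q
        | ≢0⇒≡1 (zero-one E (suc i) (suc j)) (transitive E (suc i) zero (suc j)
            (p ∘ trans (symmetric E zero (suc i))) q) = refl

removeClass-out : ∀ {n} (K : Mat (suc n)) i j → K zero (suc i) ≡ 0ℤ → removeClass K i j ≡ K (suc i) (suc j)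
removeClass-out K i j p rewrite p = trans (cong (λ u → K (suc i) (suc j) - u) (*-zeroˡ (K zero (suc j))))
    (+-identityʳ _)

removeClass-partialEquivalence : ∀ {n} {K : Mat (suc n)} → PartialEquivalence K → PartialEquivalence
    (removeClass K)
removeClass-partialEquivalence {K = K} E = λ where
    .zero-one i j → zo i j
    .symmetric i j → cong₂ _-_ (symmetric E (suc i) (suc j)) (*-comm (K zero (suc i)) (K zero (suc j)))
    .transitive i j k p q → λ r → transitive E (suc i) (suc j) (suc k)
       (p ∘ trans (removeClass-out K i j (out p))) (q ∘ trans (removeClass-out K j k (out q)))
       (trans (sym (removeClass-out K i k (out p))) r)
  where
  out : ∀ {i j} → removeClass K i j ≢ 0ℤ → K zero (suc i) ≡ 0ℤ
  out {i} {j} p with K zero (suc i) ≟ 0ℤ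
  ... | yes q = q
  ... | no q = contradiction (removeClass-in E i j q) p
  zo : ∀ i j → ZeroOne (removeClass K i j)
  zo i j with K zero (suc i) ≟ 0ℤ
  ... | yes q = subst ZeroOne (sym (removeClass-out K i j q)) (zero-one E (suc i) (suc j))
  ... | no q = inj₁ (removeClass-in E i j q)

-- The term `(r ∙ y) * (r ∙ y)` is what `removeClass` subtracts. When `K zero zero` is 1 it
-- completes the square of `x zero + r ∙ y`.
bil-suc : ∀ {n} {K : Mat (suc n)} → Symmetric K → ∀ x → let r = λ i → K zero (suc i) ; y = λ i → x (suc i) in
  bil K x x ≡ K zero zero * (x zero * x zero) + + 2 * (x zero * (r ∙ y)) + (r ∙ y) * (r ∙ y) + bil
      (removeClass K) y y
bil-suc {n} {K} s x = begin
  sum (λ i → x i * app K x i)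
    ≡⟨ sum-suc (λ i → x i * app K x i) ⟩
  a * app K x zero + sum (λ i → y i * app K x (suc i))
    ≡⟨ cong₂ (λ u v → a * u + v) (sum-suc (λ j → K zero j * x j)) (∑-cong λ i → cong (y i *_) (row i)) ⟩
  a * (K zero zero * a + ρ) + sum (λ i → y i * (r i * a + (r i * ρ + app K′ y i)))
    ≡⟨ cong (_+_ (a * (K zero zero * a + ρ))) (trans (∑-cong λ i → eq (y i) (r i) a ρ (app K′ y i))
        (∑-lin (a + ρ) 1ℤ (λ i → r i * y i) (λ i → y i * app K′ y i))) ⟩
  a * (K zero zero * a + ρ) + ((a + ρ) * ρ + 1ℤ * bil K′ y y)
    ≡⟨ eq₂ a (K zero zero) ρ (bil K′ y y) ⟩
  K zero zero * (a * a) + + 2 * (a * ρ) + ρ * ρ + bil K′ y y ∎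
  where
  open ≡-Reasoning
  a = x zero
  r y : Vect n
  r i = K zero (suc i)
  y i = x (suc i)
  ρ = r ∙ y
  K′ = removeClass K
  eq : ∀ y r a ρ p → y * (r * a + (r * ρ + p)) ≡ (a + ρ) * (r * y) + 1ℤ * (y * p)
  eq = solve-∀
  eq₂ : ∀ a k ρ b → a * (k * a + ρ) + ((a + ρ) * ρ + 1ℤ * b) ≡ k * (a * a) + + 2 * (a * ρ) + ρ * ρ + b
  eq₂ = solve-∀
  eq₃ : ∀ k p q y → k * y ≡ p * (q * y) + 1ℤ * ((k - p * q) * y)
  eq₃ = solve-∀
  row : ∀ i → app K x (suc i) ≡ r i * a + (r i * ρ + app K′ y i)
  row i = trans (sum-suc (λ j → K (suc i) j * x j)) (cong₂ _+_ (cong (_* a) (s (suc i) zero))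
    (trans (∑-cong λ j → eq₃ (K (suc i) (suc j)) (r i) (r j) (y j))
    (trans (∑-lin (r i) 1ℤ (λ j → r j * y j) (λ j → K′ i j * y j))
        (cong (_+_ (r i * ρ)) (*-identityˡ (app K′ y i))))))

-- The form is the sum of the squared class sums of `x`; each step of the induction splits off the
-- class of the first index.
partialEquivalence-psd : ∀ {n} {K : Mat n} → PartialEquivalence K → ∀ x → 0ℤ ≤ bil K x x
partialEquivalence-psd {zero} E x = ∑-0≤ λ ()
partialEquivalence-psd {suc n} {K} E x = subst (0ℤ ≤_) (sym (bil-suc (symmetric E) x))
  (0≤+ square (partialEquivalence-psd (removeClass-partialEquivalence E) (λ i → x (suc i))))
  where
  ρ = sum (λ i → K zero (suc i) * x (suc i))
  a = x zero
  eq : ∀ a ρ → (a + ρ) * (a + ρ) ≡ 1ℤ * (a * a) + + 2 * (a * ρ) + ρ * ρ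
  eq = solve-∀
  eq₀ : ∀ a → 0ℤ ≡ 0ℤ * (a * a) + + 2 * (a * 0ℤ) + 0ℤ * 0ℤ
  eq₀ = solve-∀
  square : 0ℤ ≤ K zero zero * (a * a) + + 2 * (a * ρ) + ρ * ρ
  square with zero-one E zero zero
  ... | inj₂ p = subst (λ u → 0ℤ ≤ u * (a * a) + + 2 * (a * ρ) + ρ * ρ) (sym p) (subst (0ℤ ≤_) (eq a ρ)
      (0≤sq (a + ρ)))
  ... | inj₁ p = subst₂ (λ u v → 0ℤ ≤ u * (a * a) + + 2 * (a * v) + v * v) (sym p) (sym ρ≡0)
      (≤-reflexive (eq₀ a))
    where
    ρ≡0 : ρ ≡ 0ℤ
    ρ≡0 = ∑-zero λ i → trans (cong (_* x (suc i)) (r≡0 i)) (*-zeroˡ (x (suc i)))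
      where
      r≡0 : ∀ i → K zero (suc i) ≡ 0ℤ
      r≡0 i with K zero (suc i) ≟ 0ℤ
      ... | yes q = q
      -- An index related to `zero` would make `zero` related to itself.
      ... | no q = contradiction p (transitive E zero (suc i) zero q (q ∘ trans (symmetric E zero (suc i))))

-- A rank two matroid is a complete multipartite graph on its non-loops, so
-- x M x = (p ∙ x)² − x N x with p the indicator of the non-loops and N parallelism.
hyper-rank-two : ∀ {n} {M : Mat n} → (∀ i j → ZeroOne (M i j)) → Symmetric M → RankTwoSupport M → Hyper M
hyper-rank-two {n} {M} zo s support = hyper-from-functional s p λ x h →
  ≤-trans (≤-reflexive (split x h)) (neg-mono-≤ (partialEquivalence-psd N-equivalence x))
  where
  nonloop? : ∀ i → Dec (∃ λ k → M i k ≢ 0ℤ)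
  nonloop? i = any? λ k → ¬? (M i k ≟ 0ℤ)
  p : Vect n
  p i with nonloop? i
  ... | yes _ = 1ℤ
  ... | no _ = 0ℤ
  p-nonloop : ∀ {i} → p i ≢ 0ℤ → ∃ λ k → M i k ≢ 0ℤ
  p-nonloop {i} h with nonloop? i
  ... | yes q = q
  ... | no _ = contradiction refl h
  p-one : ∀ {i k} → M i k ≢ 0ℤ → p i ≡ 1ℤ
  p-one {i} {k} h with nonloop? i
  ... | yes _ = refl
  ... | no q = contradiction (k , h) q
  p-zo : ∀ i → ZeroOne (p i)
  p-zo i with nonloop? i
  ... | yes _ = inj₂ refl
  ... | no _ = inj₁ refl
  N : Mat n
  N i j = p i * p j - M i j
  N-adjacent : ∀ {i j} → M i j ≢ 0ℤ → N i j ≡ 0ℤ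
  N-adjacent {i} {j} h rewrite p-one h | p-one (h ∘ trans (s i j)) | ≢0⇒≡1 (zo i j) h = refl
  N-apart : ∀ {i j} → M i j ≡ 0ℤ → N i j ≡ p i * p j
  N-apart {i} {j} h = trans (cong (λ u → p i * p j - u) h) (+-identityʳ (p i * p j))
  N⇒ : ∀ {i j} → N i j ≢ 0ℤ → M i j ≡ 0ℤ × p i ≢ 0ℤ × p j ≢ 0ℤ
  N⇒ {i} {j} h with M i j ≟ 0ℤ
  ... | no q = contradiction (N-adjacent q) h
  ... | yes q = q , (λ z → h (trans (N-apart q) (trans (cong (_* p j) z) (*-zeroˡ (p j))))) ,
      (λ z → h (trans (N-apart q) (trans (cong (p i *_) z) (*-zeroʳ (p i)))))
  N-zo : ∀ i j → ZeroOne (N i j)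
  N-zo i j with M i j ≟ 0ℤ
  ... | no q = inj₁ (N-adjacent q)
  ... | yes q = subst ZeroOne (sym (N-apart q)) (prod (p-zo i) (p-zo j))
    where
    prod : ∀ {a b} → ZeroOne a → ZeroOne b → ZeroOne (a * b)
    prod {b = b} (inj₁ refl) _ = inj₁ (*-zeroˡ b)
    prod {b = b} (inj₂ refl) h = subst ZeroOne (sym (*-identityˡ b)) h
  N-transitive : ∀ i j k → N i j ≢ 0ℤ → N j k ≢ 0ℤ → N i k ≢ 0ℤ
  N-transitive i j k h h′ with N⇒ h | N⇒ h′ | M i k ≟ 0ℤ
  ... | _ , pi , _ | _ , _ , pk | yes q = λ z → *-≢0 {n} {p i} {p k} pi pk (trans (sym (N-apart q)) z)
  -- If `i` and `k` were adjacent, exchange with an edge at the non-loop `j` would make `j` adjacent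
  -- to `i` or to `k`.
  ... | Mij , _ , pj | Mjk , _ , _ | no q with p-nonloop pj
  ...   | l , r with support q r
  ...     | inj₁ t = contradiction Mij t
  ...     | inj₂ t = contradiction Mjk t
  N-equivalence : PartialEquivalence N
  N-equivalence .zero-one = N-zo
  N-equivalence .symmetric i j = cong₂ _-_ (*-comm (p i) (p j)) (s i j)
  N-equivalence .transitive = N-transitive
  split : ∀ x → p ∙ x ≡ 0ℤ → bil M x x ≡ - bil N x x
  split x h = begin
    bil M x x                                              ≡⟨ ∑-cong (λ i → cong (x i *_) (row i)) ⟩
    sum (λ i → x i * (p i * (p ∙ x) + - 1ℤ * app N x i))
        ≡⟨ ∑-cong (λ i → trans (cong (λ u → x i * (p i * u + - 1ℤ * app N x i)) h)
        (eq (x i) (p i) (app N x i))) ⟩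
    sum (λ i → - 1ℤ * (x i * app N x i))
        ≡⟨ sym (*-distribˡ-sum (- 1ℤ) (λ i → x i * app N x i)) ⟩
    - 1ℤ * bil N x x                                       ≡⟨ -1*i≡-i (bil N x x) ⟩
    - bil N x x                                            ∎
    where
    open ≡-Reasoning
    eq : ∀ x p a → x * (p * 0ℤ + - 1ℤ * a) ≡ - 1ℤ * (x * a)
    eq = solve-∀
    eq₂ : ∀ m p q x → m * x ≡ p * (q * x) + - 1ℤ * ((p * q - m) * x)
    eq₂ = solve-∀
    row : ∀ i → app M x i ≡ p i * (p ∙ x) + - 1ℤ * app N x i
    row i = trans (∑-cong λ j → eq₂ (M i j) (p i) (p j) (x j)) (∑-lin (p i) (- 1ℤ) (λ j → p j * x j)
        (λ j → N i j * x j))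

-- Induction on the number of contractions

hyper-avgs : ∀ {n} {ws} → All NonNegative-vec ws → {φ : Tensor {n}} → Matroidal φ → (∀ l → ZeroOne (φ l))
    → Hyper (mat (avgs ws φ))
hyper-avgs [] m zo = hyper-rank-two (λ i j → zo (i ∷ j ∷ [])) (mat-sym m) (mat-support m)
-- The induction runs over all `φ` at once, since slices of `φ` are again matroidal and zero-one;
-- `avgs-slice` identifies slices of the average with averages of slices.
hyper-avgs {ws = w ∷ ws} (w≥0 ∷ ws≥0) {φ} m zo = hyper-avg (avgs-matroidal ws≥0 m)
  (λ i → hyper-cong (mat (avgs ws (slice i φ))) (mat (slice i (avgs ws φ))) (λ a b → avgs-slice ws≥0 m i
      (a ∷ b ∷ []))
    (hyper-avgs ws≥0 (slice-matroidal m i) (λ l → zo (i ∷ l)))) w w≥0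

avgs-↭ : ∀ {n} {us vs} → us ↭ vs → All NonNegative-vec us → {φ : Tensor {n}} → Matroidal φ
    → avgs us φ ≗ avgs vs φ
avgs-↭ refl _ m l = refl
avgs-↭ (prep w p) (_ ∷ ps) m l = avg-cong w (avgs-↭ p ps m) l
avgs-↭ {n} (swap {us} {vs} v w p) (v≥0 ∷ w≥0 ∷ ps) {φ} m l = trans (avg-cong v (avg-cong w (avgs-↭ p ps m))
    l) (begin
  sum (λ i → v i * sum (λ j → w j * ψ (j ∷ i ∷ l)))  ≡⟨ ∑-cong (λ i → *-distribˡ-sum (v i)
      (λ j → w j * ψ (j ∷ i ∷ l))) ⟩
  sum (λ i → sum (λ j → v i * (w j * ψ (j ∷ i ∷ l))))  ≡⟨ ∑-comm (λ i j → v i * (w j * ψ (j ∷ i ∷ l))) ⟩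
  sum (λ j → sum (λ i → v i * (w j * ψ (j ∷ i ∷ l))))  ≡⟨ ∑-cong (λ j → ∑-cong λ i
      → trans (eq (v i) (w j) (ψ (j ∷ i ∷ l))) (cong (λ u → w j * (v i * u)) (flip i j))) ⟩
  sum (λ j → sum (λ i → w j * (v i * ψ (i ∷ j ∷ l))))
      ≡⟨ ∑-cong (λ j → sym (*-distribˡ-sum (w j) (λ i → v i * ψ (i ∷ j ∷ l)))) ⟩
  sum (λ j → w j * sum (λ i → v i * ψ (i ∷ j ∷ l)))  ∎)
  where
  open ≡-Reasoning
  ψ = avgs vs φ
  eq : ∀ a b c → a * (b * c) ≡ b * (a * c)
  eq = solve-∀
  vs≥0 : All NonNegative-vec vs
  vs≥0 = All-resp-↭ p ps
  flip : ∀ i j → ψ (j ∷ i ∷ l) ≡ ψ (i ∷ j ∷ l)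
  flip i j = Matroidal.swap₂ (avgs-matroidal vs≥0 m) j i l
avgs-↭ {us = us} (↭-trans p q) ps m l = trans (avgs-↭ p ps m l) (avgs-↭ q (All-resp-↭ p ps) m l)

-- This is `Hyper` at `x` and `y`; its sign hypothesis is automatic, as all weights and all values
-- of `φ` are non-negative.
avgs-log-concave : ∀ {n} {ws} → All NonNegative-vec ws → {φ : Tensor {n}} → Matroidal φ
    → (∀ l → ZeroOne (φ l)) →
  ∀ {x y} → NonNegative-vec x → NonNegative-vec y →
  avgs (x ∷ x ∷ ws) φ [] * avgs (y ∷ y ∷ ws) φ [] ≤ avgs (x ∷ y ∷ ws) φ [] * avgs (x ∷ y ∷ ws) φ []
avgs-log-concave {n} {ws} ws≥0 {φ} m zo {x} {y} x≥0 y≥0 =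
  subst₂ _≤_ (cong₂ _*_ (≡bil x x) (≡bil y y)) (cong₂ _*_ (≡bil x y) (≡bil x y))
    (hyper-avgs ws≥0 m zo x y (subst (0ℤ ≤_) (sym (≡bil y y))
        (Matroidal.0≤ (avgs-matroidal (y≥0 ∷ y≥0 ∷ ws≥0) m) [])))
  where
  ψ = avgs ws φ
  ≡bil : ∀ u v → bil (mat ψ) u v ≡ avgs (u ∷ v ∷ ws) φ []
  ≡bil u v = ∑-cong λ i → cong (u i *_) (∑-cong λ j → trans (*-comm (ψ (i ∷ j ∷ [])) (v j))
      (cong (v j *_) (Matroidal.swap₂ (avgs-matroidal ws≥0 m) i j [])))

-- Ordered bases of a matroid

open Matroid

x∈p─q⇒x∉q : ∀ {n} (p q : Subset n) {x} → x ∈ˢ p ─ q → x ∉ˢ q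
x∈p─q⇒x∉q (s ∷ p) (outside ∷ q) here ()
x∈p─q⇒x∉q (s ∷ p) (t ∷ q) (there h) (there k) = x∈p─q⇒x∉q p q h k

∣⁅x⁆∪p∣≤1+∣p∣ : ∀ {n} (x : Fin n) p → ∣ ⁅ x ⁆ ∪ p ∣ˢ ℕ.≤ suc ∣ p ∣ˢ
∣⁅x⁆∪p∣≤1+∣p∣ zero (s ∷ p) = s≤s (subst (λ q → ∣ q ∣ˢ ℕ.≤ ∣ s ∷ p ∣ˢ) (sym (∪-identityˡ p)) (∣p∣≤∣x∷p∣ s p))
∣⁅x⁆∪p∣≤1+∣p∣ (suc x) (inside ∷ p) = s≤s (∣⁅x⁆∪p∣≤1+∣p∣ x p)
∣⁅x⁆∪p∣≤1+∣p∣ (suc x) (outside ∷ p) = ∣⁅x⁆∪p∣≤1+∣p∣ x p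

p⊆⁅x⁆∪[p-x] : ∀ {n} (p : Subset n) x → p ⊆ˢ ⁅ x ⁆ ∪ (p -ˢ x)
p⊆⁅x⁆∪[p-x] p x {z} z∈p with z Fin.≟ x
... | yes refl = x∈p∪q⁺ (inj₁ (x∈⁅x⁆ x))
... | no z≢x = x∈p∪q⁺ (inj₂ (x∈p∧x≢y⇒x∈p-y z∈p z≢x))

∣p∣≤∣[p-x]∪⁅y⁆∣ : ∀ {n} (p : Subset n) x {y} → y ∉ˢ p → ∣ p ∣ˢ ℕ.≤ ∣ (p -ˢ x) ∪ ⁅ y ⁆ ∣ˢ
∣p∣≤∣[p-x]∪⁅y⁆∣ p x {y} y∉p = ℕ.≤-trans (p⊆q⇒∣p∣≤∣q∣ (p⊆⁅x⁆∪[p-x] p x)) (ℕ.≤-trans (∣⁅x⁆∪p∣≤1+∣p∣ x (p -ˢ x))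
  (p⊂q⇒∣p∣<∣q∣ (p⊆p∪q ⁅ y ⁆ , y , x∈p∪q⁺ (inj₂ (x∈⁅x⁆ y)) , y∉p ∘ p─q⊆p p ⁅ x ⁆)))

module _ {n} (M : Matroid n) where

  -- Exchanging an element of `B ─ B₂` for one of `B₂` does not shrink `B` but shrinks the
  -- difference, until `B ⊆ B₂`. The counter `k` bounds the difference.
  ∣basis∣-≤ : ∀ {B₁ B₂} → IsBasis M B₁ → IsBasis M B₂ → ∣ B₁ ∣ˢ ℕ.≤ ∣ B₂ ∣ˢ
  ∣basis∣-≤ {B₁} {B₂} b₁ b₂ = go (suc ∣ B₁ ─ B₂ ∣ˢ) ℕ.≤-refl b₁
    where
    go : ∀ k {B} → ∣ B ─ B₂ ∣ˢ ℕ.< k → IsBasis M B → ∣ B ∣ˢ ℕ.≤ ∣ B₂ ∣ˢ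
    go (suc k) {B} (s≤s l) b with nonempty? (B ─ B₂)
    ... | no ¬ne = p⊆q⇒∣p∣≤∣q∣ B⊆B₂
      where
      B⊆B₂ : B ⊆ˢ B₂
      B⊆B₂ {z} z∈B with z ∈? B₂
      ... | yes h = h
      ... | no h = contradiction (z , x∈p∧x∉q⇒x∈p─q z∈B h) ¬ne
    ... | yes (x , x∈) with exchange M b b₂ (p─q⊆p B B₂ x∈) (x∈p─q⇒x∉q B B₂ x∈)
    ...   | y , y∈B₂ , y∉B , b′ = ℕ.≤-trans (∣p∣≤∣[p-x]∪⁅y⁆∣ B x y∉B)
      (go k (ℕ.<-≤-trans (p⊂q⇒∣p∣<∣q∣ (sub , x , x∈ , x∉)) l) b′)
      where
      B′ = (B -ˢ x) ∪ ⁅ y ⁆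
      x∉ : x ∉ˢ B′ ─ B₂
      x∉ h with x∈p∪q⁻ (B -ˢ x) ⁅ y ⁆ (p─q⊆p B′ B₂ h)
      ... | inj₁ x∈B-x = x∈p─q⇒x∉q B ⁅ x ⁆ x∈B-x (x∈⁅x⁆ x)
      ... | inj₂ x∈y = x∈p─q⇒x∉q B B₂ x∈ (subst (_∈ˢ B₂) (sym (x∈⁅y⁆⇒x≡y y x∈y)) y∈B₂)
      sub : B′ ─ B₂ ⊆ˢ B ─ B₂
      sub {z} h with x∈p∪q⁻ (B -ˢ x) ⁅ y ⁆ (p─q⊆p B′ B₂ h)
      ... | inj₁ z∈ = x∈p∧x∉q⇒x∈p─q (p─q⊆p B ⁅ x ⁆ z∈) (x∈p─q⇒x∉q B′ B₂ h)
      ... | inj₂ z∈y = contradiction (subst (_∈ˢ B₂) (sym (x∈⁅y⁆⇒x≡y y z∈y)) y∈B₂) (x∈p─q⇒x∉q B′ B₂ h)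

  rank-≤-∣basis∣ : ∀ {B} → IsBasis M B → rank M ℕ.≤ ∣ B ∣ˢ
  rank-≤-∣basis∣ = ∣basis∣-≤ (proj₂ (nonempty M))

elementSet : ∀ {n} → List (Fin n) → Subset n
elementSet l = ⋃ (List.map ⁅_⁆ l)

∈-elementSet⁻ : ∀ {n} (l : List (Fin n)) {x} → x ∈ˢ elementSet l → x ∈ l
∈-elementSet⁻ [] h = contradiction h ∉⊥
∈-elementSet⁻ (a ∷ l) h with x∈p∪q⁻ ⁅ a ⁆ (elementSet l) h
... | inj₁ p = here (x∈⁅y⁆⇒x≡y a p)
... | inj₂ p = there (∈-elementSet⁻ l p)

∣elementSet∣≤length : ∀ {n} (l : List (Fin n)) → ∣ elementSet l ∣ˢ ℕ.≤ length l
∣elementSet∣≤length {n} [] = ℕ.≤-reflexive (∣⊥∣≡0 n)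
∣elementSet∣≤length (a ∷ l) = ℕ.≤-trans (∣⁅x⁆∪p∣≤1+∣p∣ a (elementSet l)) (s≤s (∣elementSet∣≤length l))

elementSet-↭ : ∀ {n} {l l′ : List (Fin n)} → l ↭ l′ → elementSet l ≡ elementSet l′
elementSet-↭ refl = refl
elementSet-↭ (prep a p) = cong (⁅ a ⁆ ∪_) (elementSet-↭ p)
elementSet-↭ {l = a ∷ b ∷ l} {_ ∷ _ ∷ l′} (swap a b p) = begin
  ⁅ a ⁆ ∪ (⁅ b ⁆ ∪ elementSet l)    ≡⟨ sym (∪-assoc ⁅ a ⁆ ⁅ b ⁆ (elementSet l)) ⟩
  (⁅ a ⁆ ∪ ⁅ b ⁆) ∪ elementSet l    ≡⟨ cong₂ _∪_ (∪-comm ⁅ a ⁆ ⁅ b ⁆) (elementSet-↭ p) ⟩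
  (⁅ b ⁆ ∪ ⁅ a ⁆) ∪ elementSet l′   ≡⟨ ∪-assoc ⁅ b ⁆ ⁅ a ⁆ (elementSet l′) ⟩
  ⁅ b ⁆ ∪ (⁅ a ⁆ ∪ elementSet l′)   ∎
  where open ≡-Reasoning
elementSet-↭ (↭-trans p q) = trans (elementSet-↭ p) (elementSet-↭ q)

indicator : ∀ {P : Set} → Dec P → ℤ
indicator (yes _) = 1ℤ
indicator (no _) = 0ℤ

indicator-zero-one : ∀ {P} (P? : Dec P) → ZeroOne (indicator P?)
indicator-zero-one (yes _) = inj₂ refl
indicator-zero-one (no _) = inj₁ refl

indicator-0≤ : ∀ {P} (P? : Dec P) → 0ℤ ≤ indicator P?
indicator-0≤ (yes _) = +≤+ z≤n
indicator-0≤ (no _) = +≤+ z≤n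

indicator-true : ∀ {P} (P? : Dec P) → P → indicator P? ≢ 0ℤ
indicator-true (yes _) p ()
indicator-true (no ¬p) p = contradiction p ¬p

indicator-≢0 : ∀ {P} (P? : Dec P) → indicator P? ≢ 0ℤ → P
indicator-≢0 (yes p) _ = p
indicator-≢0 (no _) h = contradiction refl h

indicator-false : ∀ {P} (P? : Dec P) → ¬ P → indicator P? ≡ 0ℤ
indicator-false (yes p) ¬p = contradiction p ¬p
indicator-false (no _) _ = refl

indicator-⇔ : ∀ {P Q} (P? : Dec P) (Q? : Dec Q) → (P → Q) → (Q → P) → indicator P? ≡ indicator Q?
indicator-⇔ (yes _) (yes _) _ _ = refl
indicator-⇔ (no _) (no _) _ _ = refl
indicator-⇔ (yes p) (no ¬q) f _ = contradiction (f p) ¬q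
indicator-⇔ (no ¬p) (yes q) _ g = contradiction (g q) ¬p

module _ {n} (M : Matroid n) where

  -- Fixing the length at the rank excludes repeated entries, which `elementSet` would collapse.
  record BasisSequence (l : List (Fin n)) : Set where
    constructor _,_
    field
      length-rank : length l ≡ rank M
      isBasis     : IsBasis M (elementSet l)

  basisSequence? : Decidable BasisSequence
  basisSequence? l = map′ (λ (e , b) → e , b) (λ (e , b) → e , b) ((length l ℕ.≟ rank M) ×-dec isBasis? M
      (elementSet l))

  basisTensor : Tensor {n}
  basisTensor l = indicator (basisSequence? l)

  BasisSequence-↭ : ∀ {l l′} → l ↭ l′ → BasisSequence l → BasisSequence l′
  BasisSequence-↭ p (e , b) = trans (sym (↭-length p)) e , subst (IsBasis M) (elementSet-↭ p) b

  -- A repeated entry would leave fewer than `rank M` elements, while every basis has at least that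
  -- many.
  BasisSequence-fresh : ∀ {a l} → BasisSequence (a ∷ l) → a ∉ˢ elementSet l
  BasisSequence-fresh {a} {l} (e , b) a∈l = ℕ.<⇒≱ small (rank-≤-∣basis∣ M b)
    where
    absorb : elementSet (a ∷ l) ⊆ˢ elementSet l
    absorb {z} h with x∈p∪q⁻ ⁅ a ⁆ (elementSet l) h
    ... | inj₁ p = subst (_∈ˢ elementSet l) (sym (x∈⁅y⁆⇒x≡y a p)) a∈l
    ... | inj₂ p = p
    small : ∣ elementSet (a ∷ l) ∣ˢ ℕ.< rank M
    small = subst (∣ elementSet (a ∷ l) ∣ˢ ℕ.<_) e (s≤s (ℕ.≤-trans (p⊆q⇒∣p∣≤∣q∣ absorb)
        (∣elementSet∣≤length l)))

  BasisSequence-exchange : ∀ {a as bs} → BasisSequence (a ∷ as) → BasisSequence bs → ∃ λ b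
      → b ∈ bs × BasisSequence (b ∷ as)
  BasisSequence-exchange {a} {as} {bs} s@(e , p) (_ , q) with a ∈? elementSet bs
  -- The exchange axiom of `M` needs `a` outside the other basis; otherwise `a` itself is the
  -- answer.
  ... | yes a∈bs = a , ∈-elementSet⁻ bs a∈bs , s
  ... | no a∉bs with exchange M p q (x∈p∪q⁺ (inj₁ (x∈⁅x⁆ a))) a∉bs
  ...   | b , b∈bs , _ , r = b , ∈-elementSet⁻ bs b∈bs , e , subst (IsBasis M) (⊆-antisym to from) r
    where
    A = elementSet as
    to : ((⁅ a ⁆ ∪ A) -ˢ a) ∪ ⁅ b ⁆ ⊆ˢ ⁅ b ⁆ ∪ A
    to h with x∈p∪q⁻ ((⁅ a ⁆ ∪ A) -ˢ a) ⁅ b ⁆ h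
    ... | inj₂ h₁ = x∈p∪q⁺ (inj₁ h₁)
    ... | inj₁ h₁ with x∈p∪q⁻ ⁅ a ⁆ A (p─q⊆p (⁅ a ⁆ ∪ A) ⁅ a ⁆ h₁)
    ...   | inj₁ h₂ = contradiction h₂ (x∈p─q⇒x∉q (⁅ a ⁆ ∪ A) ⁅ a ⁆ h₁)
    ...   | inj₂ h₂ = x∈p∪q⁺ (inj₂ h₂)
    from : ⁅ b ⁆ ∪ A ⊆ˢ ((⁅ a ⁆ ∪ A) -ˢ a) ∪ ⁅ b ⁆
    from h with x∈p∪q⁻ ⁅ b ⁆ A h
    ... | inj₁ h₁ = x∈p∪q⁺ (inj₂ h₁)
    ... | inj₂ h₁ = x∈p∪q⁺ (inj₁ (x∈p∧x≢y⇒x∈p-y (x∈p∪q⁺ (inj₂ h₁)) λ { refl → BasisSequence-fresh s h₁ }))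

  basisTensor-matroidal : Matroidal basisTensor
  basisTensor-matroidal .Matroidal.perm {l} {l′} p = indicator-⇔ (basisSequence? l) (basisSequence? l′)
    (BasisSequence-↭ p) (BasisSequence-↭ (↭-sym p))
  basisTensor-matroidal .Matroidal.repeat-0 c l = indicator-false (basisSequence? (c ∷ c ∷ l))
    λ s → BasisSequence-fresh s (x∈p∪q⁺ (inj₁ (x∈⁅x⁆ c)))
  basisTensor-matroidal .Matroidal.0≤ l = indicator-0≤ (basisSequence? l)
  basisTensor-matroidal .Matroidal.exchange {a} {as} {bs} p q
    with BasisSequence-exchange (indicator-≢0 (basisSequence? (a ∷ as)) p)
        (indicator-≢0 (basisSequence? bs) q)
  ... | b , b∈ , s = b , b∈ , indicator-true (basisSequence? (b ∷ as)) s

  basisTensor-zero-one : ∀ l → ZeroOne (basisTensor l)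
  basisTensor-zero-one l = indicator-zero-one (basisSequence? l)

  basisTensor-toList : ∀ {s} → s ≡ rank M → (y : Vec (Fin n) s) → basisTensor (toList y) ≡ indicator
      (isBasis? M (underlyingSet y))
  basisTensor-toList e y = indicator-⇔ (basisSequence? (toList y)) (isBasis? M (underlyingSet y))
    (subst (IsBasis M) (sym same) ∘ BasisSequence.isBasis) (λ b → trans (Vec.length-toList y) e , subst
        (IsBasis M) same b)
    where
    same : underlyingSet y ≡ elementSet (toList y)
    same = cong ⋃ (Vec.toList-map ⁅_⁆ y)

-- Counting

memberIndicator : ∀ {n} → Subset n → Vect n
memberIndicator S i = indicator (i ∈? S)

memberIndicator-0≤ : ∀ {n} (S : Subset n) → NonNegative-vec (memberIndicator S)
memberIndicator-0≤ S i = indicator-0≤ (i ∈? S)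

+length-filter-∷ : ∀ {A : Set} {P : A → Set} (P? : Decidable P) x xs →
  + length (filter P? (x ∷ xs)) ≡ indicator (P? x) + + length (filter P? xs)
+length-filter-∷ P? x xs with P? x
... | yes _ = refl
... | no _ = sym (+-identityˡ _)

length-filter-map : ∀ {A B : Set} {P : B → Set} (P? : Decidable P) (f : A → B) xs →
  length (filter P? (List.map f xs)) ≡ length (filter (P? ∘ f) xs)
length-filter-map P? f [] = refl
length-filter-map P? f (x ∷ xs) with P? (f x)
... | yes _ = cong suc (length-filter-map P? f xs)
... | no _ = length-filter-map P? f xs

-- The general `g` serves the induction on `k`, which passes to `g ∘ suc`; `allFin` is the case
-- `g = id`.
length-filter-product : ∀ {k n s} {P : Vec (Fin n) (suc s) → Set} (P? : Decidable P) (S : Subset n)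
    (g : Fin k → Fin n) (ys : List (Vec (Fin n) s)) →
  + length (filter P? (cartesianProductWith _∷_ (filter (_∈? S) (tabulate g)) ys)) ≡
  sum (λ i → memberIndicator S (g i) * + length (filter (λ y → P? (g i ∷ y)) ys))
length-filter-product {zero} P? S g ys = sym (∑-zero λ ())
length-filter-product {suc k} P? S g ys = trans step
    (sym (sum-suc (λ i → memberIndicator S (g i) * + length (filter (λ y → P? (g i ∷ y)) ys))))
  where
  rest = cartesianProductWith _∷_ (filter (_∈? S) (tabulate (g ∘ suc))) ys
  tail-sum = sum (λ i → memberIndicator S (g (suc i)) * + length (filter (λ y → P? (g (suc i) ∷ y)) ys))
  head-count = length (filter (λ y → P? (g zero ∷ y)) ys)
  step : + length (filter P? (cartesianProductWith _∷_ (filter (_∈? S) (tabulate g)) ys)) ≡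
    memberIndicator S (g zero) * + head-count + tail-sum
  step with g zero ∈? S
  ... | no _ = trans (length-filter-product P? S (g ∘ suc) ys)
      (sym (trans (cong (λ u → u + tail-sum) (*-zeroˡ (+ head-count))) (+-identityˡ tail-sum)))
  ... | yes _ = begin
    + length (filter P? (List.map (g zero ∷_) ys ++ rest))
      ≡⟨ cong (λ l → + length l) (List.filter-++ P? (List.map (g zero ∷_) ys) rest) ⟩
    + length (filter P? (List.map (g zero ∷_) ys) ++ filter P? rest)
      ≡⟨ cong +_ (List.length-++ (filter P? (List.map (g zero ∷_) ys))) ⟩
    + (length (filter P? (List.map (g zero ∷_) ys)) ℕ.+ length (filter P? rest))
      ≡⟨ cong₂ (λ a b → + a + b) (length-filter-map P? (g zero ∷_) ys) (length-filter-product P? S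
          (g ∘ suc) ys) ⟩
    + head-count + tail-sum
      ≡⟨ cong (λ u → u + tail-sum) (sym (*-identityˡ (+ head-count))) ⟩
    1ℤ * + head-count + tail-sum ∎
    where open ≡-Reasoning

weights : ∀ {n s} → Vec (Subset n) s → List (Vect n)
weights S = List.map memberIndicator (toList S)

weights-0≤ : ∀ {n s} (S : Vec (Subset n) s) → All NonNegative-vec (weights S)
weights-0≤ [] = []
weights-0≤ (S ∷ Ss) = memberIndicator-0≤ S ∷ weights-0≤ Ss

-- Fixing the first entry `i` replaces `φ` by `slice i φ`, hence the induction over all matroidal
-- `φ`.
count-choices : ∀ {n s} (S : Vec (Subset n) s) {P : Vec (Fin n) s → Set} (P? : Decidable P) {φ : Tensor {n}} →
  Matroidal φ → (∀ y → φ (toList y) ≡ indicator (P? y)) →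
  + length (filter P? (choices S)) ≡ avgs (weights S) φ []
count-choices [] P? m h = trans (+length-filter-∷ P? [] []) (trans (+-identityʳ _) (sym (h [])))
count-choices (S ∷ Ss) P? {φ} m h = trans (length-filter-product P? S id (choices Ss))
  (∑-cong λ i → cong (memberIndicator S i *_) (trans
    (count-choices Ss (λ y → P? (i ∷ y)) (slice-matroidal m i) (λ y → h (i ∷ y)))
    (avgs-slice (weights-0≤ Ss) m i [])))

basisCount-avgs : ∀ {n s} (M : Matroid n) → s ≡ rank M → (S : Vec (Subset n) s) → + basisCount M S
    ≡ avgs (weights S) (basisTensor M) []
basisCount-avgs M e S = count-choices S (λ y → isBasis? M (underlyingSet y)) (basisTensor-matroidal M)
    (basisTensor-toList M e)

-- Log-concavity of the mixed basis counts

weights-++ : ∀ {n t} (T : Vec (Subset n) t) Q k R j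
    → weights (T Vec.++ (Vec.replicate k Q Vec.++ Vec.replicate j R)) ≡
  weights T ++ (List.replicate k (memberIndicator Q) ++ List.replicate j (memberIndicator R))
weights-++ T Q k R j = trans (cong (List.map memberIndicator) (trans (Vec.toList-++ T _) (cong (toList T ++_)
    (trans (Vec.toList-++ (Vec.replicate k Q) _) (cong₂ _++_ (Vec.toList-replicate k Q)
        (Vec.toList-replicate j R))))))
  (trans (List.map-++ memberIndicator (toList T) _)
      (cong (weights T ++_) (trans (List.map-++ memberIndicator (List.replicate k Q) _)
    (cong₂ _++_ (List.map-replicate memberIndicator k Q) (List.map-replicate memberIndicator j R)))))

-- The three counts share the slots of `T`, `k` copies of `Q` and `j` copies of `R`; the two slots
-- left carry `R R`, `Q Q` or `Q R`. Two independent lengths avoid truncated subtraction.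
basisCount-log-concave : ∀ {n t} (M : Matroid n) (T : Vec (Subset n) t) (Q R : Subset n) k j
    → t ℕ.+ (suc k ℕ.+ suc j) ≡ rank M →
  let B = λ a b → basisCount M (T Vec.++ (Vec.replicate a Q Vec.++ Vec.replicate b R)) in
  B k (suc (suc j)) ℕ.* B (suc (suc k)) j ℕ.≤ B (suc k) (suc j) ℕ.^ 2
basisCount-log-concave {t = t} M T Q R k j e = drop‿+≤+ (begin
  + (B k (2 ℕ.+ j) ℕ.* B (2 ℕ.+ k) j)          ≡⟨ pos-* (B k (2 ℕ.+ j)) (B (2 ℕ.+ k) j) ⟩
  + B k (2 ℕ.+ j) * + B (2 ℕ.+ k) j            ≡⟨ cong₂ _*_ (evaluate k (2 ℕ.+ j) e₁ RR)
      (evaluate (2 ℕ.+ k) j e₂ QQ) ⟩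
  F (r ∷ r ∷ ws) * F (q ∷ q ∷ ws)              ≡⟨ *-comm (F (r ∷ r ∷ ws)) (F (q ∷ q ∷ ws)) ⟩
  F (q ∷ q ∷ ws) * F (r ∷ r ∷ ws)              ≤⟨ avgs-log-concave ws≥0 (basisTensor-matroidal M)
      (basisTensor-zero-one M) (memberIndicator-0≤ Q) (memberIndicator-0≤ R) ⟩
  F (q ∷ r ∷ ws) * F (q ∷ r ∷ ws)              ≡⟨ sym (cong₂ _*_ (evaluate (suc k) (suc j) e QR)
      (evaluate (suc k) (suc j) e QR)) ⟩
  + b * + b                                    ≡⟨ sym (pos-* b b) ⟩
  + (b ℕ.* b)                                  ≡⟨ cong (λ u → + (b ℕ.* u)) (sym (ℕ.*-identityʳ b)) ⟩
  + (b ℕ.^ 2)                                  ∎)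
  where
  open ≤-Reasoning
  B : ℕ → ℕ → ℕ
  B a b = basisCount M (T Vec.++ (Vec.replicate a Q Vec.++ Vec.replicate b R))
  b = B (suc k) (suc j)
  q = memberIndicator Q
  r = memberIndicator R
  F : List (Vect _) → ℤ
  F us = avgs us (basisTensor M) []
  blocks : ℕ → ℕ → List (Vect _)
  blocks a b = weights T ++ (List.replicate a q ++ List.replicate b r)
  ws = blocks k j
  evaluate : ∀ a b {us} → t ℕ.+ (a ℕ.+ b) ≡ rank M → blocks a b ↭ us → + B a b ≡ F us
  evaluate a b e p = trans (basisCount-avgs M e (T Vec.++ (Vec.replicate a Q Vec.++ Vec.replicate b R)))
    (avgs-↭ (subst (_↭ _) (sym (weights-++ T Q a R b)) p)
        (weights-0≤ (T Vec.++ (Vec.replicate a Q Vec.++ Vec.replicate b R))) (basisTensor-matroidal M) [])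
  ws≥0 : All NonNegative-vec ws
  ws≥0 = subst (All NonNegative-vec) (weights-++ T Q k R j)
      (weights-0≤ (T Vec.++ (Vec.replicate k Q Vec.++ Vec.replicate j R)))
  one-q : ∀ a b → blocks (suc a) b ↭ q ∷ blocks a b
  one-q a b = shift q (weights T) (List.replicate a q ++ List.replicate b r)
  one-r : ∀ a b → blocks a (suc b) ↭ r ∷ blocks a b
  one-r a b = ↭-trans (++⁺ˡ (weights T) (shift r (List.replicate a q) (List.replicate b r)))
      (shift r (weights T) _)
  QQ : blocks (2 ℕ.+ k) j ↭ q ∷ q ∷ ws
  QQ = ↭-trans (one-q (suc k) j) (prep q (one-q k j))
  QR : blocks (suc k) (suc j) ↭ q ∷ r ∷ ws
  QR = ↭-trans (one-q k (suc j)) (prep q (one-r k j))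
  RR : blocks k (2 ℕ.+ j) ↭ r ∷ r ∷ ws
  RR = ↭-trans (one-r k (suc j)) (prep r (one-r k j))
  e₁ : t ℕ.+ (k ℕ.+ (2 ℕ.+ j)) ≡ rank M
  e₁ = trans (cong (t ℕ.+_) (ℕ.+-suc k (suc j))) e
  e₂ : t ℕ.+ (2 ℕ.+ k ℕ.+ j) ≡ rank M
  e₂ = trans (cong (λ u → t ℕ.+ suc u) (sym (ℕ.+-suc k j))) e

theorem3p3p15 : ∀ {n} (M : Matroid n) (r m : ℕ) → rank M ≡ r → m ℕ.≤ r →
    (T : Vec (Subset n) (r ℕ.∸ m)) (Q R : Subset n) →
    LogConcave m (mixedBasisCount M m T Q R)
theorem3p3p15 M r m rank≡r m≤r T Q R (suc k) _ k<m with ℕ.m≤n⇒∃[o]m+o≡n k<m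
-- Here `k<m` says `2 + k ≤ m`, so `m` is `2 + k + j`, and the numbers of copies of `R` in the three
-- counts are `2 + j`, `1 + j` and `j`.
... | j , refl = log-concave (drop 2) (drop 1) (drop 0)
  where
  drop : ∀ i → i ℕ.+ (k ℕ.+ j) ℕ.∸ k ≡ i ℕ.+ j
  drop i = trans (ℕ.+-∸-assoc i (ℕ.m≤m+n k j)) (cong (i ℕ.+_) (ℕ.m+n∸m≡n k j))
  total : r ℕ.∸ m ℕ.+ (suc k ℕ.+ suc j) ≡ rank M
  total = trans (cong (r ℕ.∸ m ℕ.+_) (cong suc (ℕ.+-suc k j))) (trans (ℕ.m∸n+n≡m m≤r) (sym rank≡r))
  B : ℕ → ℕ → ℕ
  B a b = basisCount M (T Vec.++ (Vec.replicate a Q Vec.++ Vec.replicate b R))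
  -- The lengths are variables so that the equations from `drop` can be matched with `refl` instead
  -- of transporting vectors.
  log-concave : ∀ {a b c} → a ≡ 2 ℕ.+ j → b ≡ 1 ℕ.+ j → c ≡ j → B k a ℕ.* B (2 ℕ.+ k) c ℕ.≤ B (1 ℕ.+ k) b
      ℕ.^ 2
  log-concave refl refl refl = basisCount-log-concave M T Q R k j total
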